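{- Let $n\ge 8$ and let $\Gamma(G)$ be a signed graph whose underlying graph $G$ belongs to $B_n^{++}$. Then $\eta(\Gamma(G))\le n-6$.
   Context: A signed graph $\Gamma(G)=(G,\sigma)$ consists of a simple graph $G$ and a map $\sigma:E(G)\to\{+,-\}$; its adjacency matrix has entry $\sigma(v_iv_j)$ for edges and $0$ otherwise, and $\eta(\Gamma(G))$ is the multiplicity of $0$ as an eigenvalue. A bicyclic graph is a connected simple graph with $|E|=|V|+1$. The graph $\infty(p,q,1)$ ($p,q\ge3$) is obtained from vertex-disjoint cycles $C_p$, $C_q$ by identifying a vertex of $C_p$ with a vertex of $C_q$. $B_n^{++}$ is the set of bicyclic graphs on $n$ vertices obtained from some $\infty(p,q,1)$ by (possibly) attaching trees to some of its vertices. -}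

module Defs where

open import Data.Bool using (Bool; true; false; if_then_else_; _∧_)
open import Data.Nat using (ℕ; zero; suc; _+_; _≤_; _<ᵇ_)
open import Data.Integer as ℤ using (ℤ; +_; -_)
open import Data.Fin using (Fin; zero; suc; toℕ; punchIn; _≟_)
open import Data.Fin.Properties using ()
open import Data.List using (List; []; _∷_; map; allFin)
open import Data.Nat.ListAction using (sum)
open import Data.Sign using (Sign)
open import Data.Product using (Σ; _×_; ∃; ∃-syntax)
open import Relation.Nullary using (¬_; does)
open import Relation.Binary.PropositionalEquality using (_≡_)
open import Relation.Binary.Construct.Closure.ReflexiveTransitive using (Star)
open import Function.Definitions using (Injective)

-- Polynomials over ℤ as coefficient lists, lowest degree first.

Poly : Set
Poly = List ℤ

infixl 6 _⊕_
infixl 7 _⊗_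

_⊕_ : Poly → Poly → Poly
[] ⊕ q = q
(a ∷ p) ⊕ [] = a ∷ p
(a ∷ p) ⊕ (b ∷ q) = (a ℤ.+ b) ∷ (p ⊕ q)

scale : ℤ → Poly → Poly
scale c = map (c ℤ.*_)

_⊗_ : Poly → Poly → Poly
[] ⊗ q = []
(a ∷ p) ⊗ q = scale a q ⊕ (+ 0 ∷ (p ⊗ q))

negP : Poly → Poly
negP = scale (- (+ 1))

const : ℤ → Poly
const c = c ∷ []

X : Poly
X = + 0 ∷ + 1 ∷ []

sumFin : ∀ {n} → (Fin n → Poly) → Poly
sumFin {zero} f = []
sumFin {suc n} f = f zero ⊕ sumFin (λ i → f (suc i))

det : ∀ n → (Fin n → Fin n → Poly) → Poly
det zero M = const (+ 1)
det (suc n) M = go n M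
  where
  sgn : ∀ {m} → Fin m → Poly
  sgn zero = const (+ 1)
  sgn (suc j) = negP (sgn j)
  go : ∀ n → (Fin (suc n) → Fin (suc n) → Poly) → Poly
  go n M = sumFin (λ j → sgn j ⊗ M zero j ⊗
                     det n (λ i k → M (suc i) (punchIn j k)))

-- Multiplicity of 0 as a root: number of vanishing lowest coefficients.
-- (Applied only to characteristic polynomials, which are monic, hence nonzero.)
mult0 : Poly → ℕ
mult0 [] = zero
mult0 (c ∷ cs) = if does (c ℤ.≟ + 0) then suc (mult0 cs) else zero

record Graph (n : ℕ) : Set where
  field
    adj      : Fin n → Fin n → Bool
    adj-sym  : ∀ i j → adj i j ≡ adj j i
    adj-irr  : ∀ i → adj i i ≡ false
open Graph public

record SignedGraph (n : ℕ) : Set where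
  field
    graph    : Graph n
    sign     : Fin n → Fin n → Sign   -- σ(v_i v_j), relevant only on edges
    sign-sym : ∀ i j → sign i j ≡ sign j i
open SignedGraph public

signℤ : Sign → ℤ
signℤ Sign.+ = + 1
signℤ Sign.- = - (+ 1)

adjMatrix : ∀ {n} → SignedGraph n → Fin n → Fin n → ℤ
adjMatrix Γ i j = if adj (graph Γ) i j then signℤ (sign Γ i j) else + 0

charPoly : ∀ {n} → SignedGraph n → Poly
charPoly {n} Γ = det n (λ i j →
  (if does (i ≟ j) then X else []) ⊕ negP (const (adjMatrix Γ i j)))

η : ∀ {n} → SignedGraph n → ℕ
η Γ = mult0 (charPoly Γ)

Edge : ∀ {n} → Graph n → Fin n → Fin n → Set
Edge G i j = adj G i j ≡ true

Connected : ∀ {n} → Graph n → Set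
Connected G = ∀ i j → Star (Edge G) i j

b2n : Bool → ℕ
b2n true = 1
b2n false = 0

edgeCount : ∀ {n} → Graph n → ℕ
edgeCount {n} G = sum (map (λ i → sum (map (λ j →
  b2n (adj G i j ∧ (toℕ i <ᵇ toℕ j))) (allFin n))) (allFin n))

nextFin : ∀ {p} → Fin p → Fin p
nextFin {suc p} i = go i
  where
  go : ∀ {m} → Fin (suc m) → Fin (suc m)
  go {zero} zero = zero
  go {suc m} zero = suc zero
  go {suc m} (suc j) with go {m} j
  ... | zero = zero
  ... | suc k = suc (suc k)

IsCycle : ∀ {n} → Graph n → (p : ℕ) → (Fin p → Fin n) → Set
IsCycle G p v = (3 ≤ p) × Injective _≡_ _≡_ v × (∀ i → Edge G (v i) (v (nextFin i)))

ContainsInfinity : ∀ {n} → Graph n → Set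
ContainsInfinity {n} G =
  ∃[ p ] ∃[ q ] Σ (Fin p → Fin n) λ u → Σ (Fin q → Fin n) λ w →
    IsCycle G p u × IsCycle G q w ×
    Σ (Fin p) λ a → Σ (Fin q) λ b → (u a ≡ w b) ×
      (∀ i j → u i ≡ w j → (i ≡ a) × (j ≡ b))

Bicyclic : ∀ {n} → Graph n → Set
Bicyclic {n} G = Connected G × (edgeCount G ≡ suc n)

-- B_n^{++}: bicyclic graphs on n vertices obtained from some ∞(p,q,1)
-- by attaching trees (equivalently: bicyclic and containing ∞(p,q,1)).
InBnPP : ∀ n → Graph n → Set
InBnPP n G = Bicyclic G × ContainsInfinity G

{-# OPTIONS --safe #-}
-- The nullity drops by at most one when a vertex is deleted. Indeed let φ be the characteristic
-- polynomial of the symmetric matrix A and u the v-th column of the adjugate of xI − A, so that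
-- (xI − A) u = φ eᵥ and uᵥ is the characteristic polynomial of A with v deleted. If x^(d+2)
-- divides φ, then comparing coefficients gives A u⁽ᵏ⁾ = u⁽ᵏ⁻¹⁾ for k ≤ d + 1; by induction
-- u⁽ᵏ⁻¹⁾ = 0, so u⁽ᵏ⁾ · u⁽ᵏ⁾ = u⁽ᵏ⁾ · A u⁽ᵏ⁺¹⁾ = A u⁽ᵏ⁾ · u⁽ᵏ⁺¹⁾ = 0 for k ≤ d, and x^(d+1)
-- divides u. Hence six vertices that induce a nonsingular subgraph force η ≤ n − 6.
--
-- Such six vertices are x₁y₁, x₂y₂, x₃y₃ with x₁ pendant in the subgraph they induce, and x₂
-- pendant once x₁ and y₁ are removed. A connected graph with n + 1 edges has at most |L| + 1
-- edges inside any nonempty set L of vertices, whereas the two cycles already have that many, so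
-- no edge joins two of their vertices except along the cycles. If a cycle has length at least 5,
-- four consecutive vertices on it off the junction and an edge of the other cycle avoiding the
-- junction do. Otherwise the two cycles have at most 7 vertices, and as n ≥ 8 some further vertex
-- is attached to one of them; it serves as x₁.
module Submission where

open import Level using (0ℓ)
open import Algebra.Bundles using (CommutativeRing)

-- Determinants over a commutative ring: Laplace expansion, row exchange, alien cofactors.

module Determinant (R : CommutativeRing 0ℓ 0ℓ) where

  open import Data.Bool using (if_then_else_)
  open import Data.Fin using (Fin; zero; suc; punchIn; punchOut; _≟_)
  open import Data.Fin.Properties using (punchIn-punchOut; punchInᵢ≢i)
  open import Data.Nat using (ℕ; zero; suc)
  open import Data.Vec.Functional using () renaming (_∷_ to _▹_)
  open import Function using (_∘_)
  open import Relation.Binary.PropositionalEquality as ≡ using (_≡_; _≢_)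
  open import Relation.Nullary using (does; yes; no; contradiction)
  open CommutativeRing R hiding (zero)
  open import Algebra.Properties.CommutativeSemigroup *-commutativeSemigroup using (x∙yz≈y∙xz)
  open import Algebra.Properties.CommutativeSemigroup +-commutativeSemigroup using ()
    renaming (x∙yz≈y∙xz to x+[y+z]≈y+[x+z])
  open import Algebra.Properties.Ring ring
    using (-0#≈0#; -‿+-comm; -‿distribˡ-*; -‿distribʳ-*; -‿involutive)
  open import Algebra.Properties.Semiring.Sum semiring
  open import Relation.Binary.Reasoning.Setoid setoid

  -x*-y≈xy : ∀ x y → - x * - y ≈ x * y
  -x*-y≈xy x y = trans (sym (-‿distribˡ-* x (- y)))
    (trans (-‿cong (sym (-‿distribʳ-* x y))) (-‿involutive (x * y)))

  sgn : ∀ {n} → Fin n → Carrier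
  sgn zero    = 1#
  sgn (suc j) = - sgn j

  sgn*sgn : ∀ {n} (j : Fin n) → sgn j * sgn j ≈ 1#
  sgn*sgn zero    = *-identityˡ 1#
  sgn*sgn (suc j) = trans (-x*-y≈xy (sgn j) (sgn j)) (sgn*sgn j)

  -- The Laplace sum with the minors `c` left free, so that a row can also be paired with minors
  -- that belong to another row.
  cofactors : ∀ {n} → (Fin n → Carrier) → (Fin n → Carrier) → Carrier
  cofactors r c = sum (λ j → sgn j * (r j * c j))

  cofactors-cong : ∀ {n} (r s c d : Fin n → Carrier) → (∀ j → r j ≈ s j) → (∀ j → c j ≈ d j) →
    cofactors r c ≈ cofactors s d
  cofactors-cong r s c d g h = sum-cong-≋ {x = λ j → sgn j * (r j * c j)} {λ j → sgn j * (s j * d j)}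
    λ j → *-congˡ (*-cong (g j) (h j))

  cofactors-* : ∀ {n} (r c : Fin n → Carrier) x → cofactors r (λ j → x * c j) ≈ x * cofactors r c
  cofactors-* r c x = trans
    (sum-cong-≋ {x = λ j → sgn j * (r j * (x * c j))} {λ j → x * (sgn j * (r j * c j))}
      λ j → trans (*-congˡ (x∙yz≈y∙xz (r j) x (c j))) (x∙yz≈y∙xz (sgn j) x (r j * c j)))
    (sym (*-distribˡ-sum x (λ j → sgn j * (r j * c j))))

  Matrix : ℕ → Set
  Matrix n = Fin n → Fin n → Carrier

  minor : ∀ {m n} → Fin (suc n) → (Fin m → Fin (suc n) → Carrier) → Fin m → Fin n → Carrier
  minor j R i k = R i (punchIn j k)

  det : ∀ n → Matrix n → Carrier
  det zero    M = 1#
  det (suc n) M = cofactors (M zero) (λ j → det n (minor j (M ∘ suc)))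

  det-cong : ∀ n {M N : Matrix n} → (∀ i j → M i j ≈ N i j) → det n M ≈ det n N
  det-cong zero    h = refl
  det-cong (suc n) {M} {N} h = cofactors-cong (M zero) (N zero) _ _ (h zero)
    λ j → det-cong n λ i k → h (suc i) (punchIn j k)

  -- The pair (j , punchIn j k) of distinct columns, read in the opposite order, is
  -- (punchIn j k , punchIn (punchIn j k) (other j k)).
  other : ∀ {m} → Fin (suc m) → Fin m → Fin m
  other {suc m} zero    k       = zero
  other {suc m} (suc j) zero    = j
  other {suc m} (suc j) (suc k) = suc (other j k)

  punchIn-other : ∀ {m} (j : Fin (suc m)) k → punchIn (punchIn j k) (other j k) ≡ j
  punchIn-other {suc m} zero    k       = ≡.refl
  punchIn-other {suc m} (suc j) zero    = ≡.refl
  punchIn-other {suc m} (suc j) (suc k) = ≡.cong suc (punchIn-other j k)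

  -- Reading the same two columns in the opposite order changes the parity by one transposition.
  sgn-other : ∀ {m} (j : Fin (suc m)) k → sgn (punchIn j k) * sgn (other j k) ≈ - (sgn j * sgn k)
  sgn-other {suc m} zero    k       = trans (*-identityʳ (- sgn k)) (-‿cong (sym (*-identityˡ (sgn k))))
  sgn-other {suc m} (suc j) zero    =
    trans (*-identityˡ (sgn j)) (trans (sym (-‿involutive (sgn j))) (-‿cong (sym (*-identityʳ (- sgn j)))))
  sgn-other {suc m} (suc j) (suc k) =
    trans (-x*-y≈xy (sgn (punchIn j k)) (sgn (other j k)))
      (trans (sgn-other j k) (-‿cong (sym (-x*-y≈xy (sgn j) (sgn k)))))

  punchIn-punchIn-other : ∀ {m} (j : Fin (suc (suc m))) k l →
    punchIn (punchIn j k) (punchIn (other j k) l) ≡ punchIn j (punchIn k l)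
  punchIn-punchIn-other zero    k       l       = ≡.refl
  punchIn-punchIn-other (suc j) zero    l       = ≡.refl
  punchIn-punchIn-other (suc j) (suc k) zero    = ≡.refl
  punchIn-punchIn-other (suc j) (suc k) (suc l) = ≡.cong suc (punchIn-punchIn-other j k l)

  -- The reindexing permutes the ordered pairs of distinct columns. The induction splits off the
  -- pairs that contain column zero and exchanges their two halves.
  sum-other : ∀ m (F : Fin (suc m) → Fin m → Carrier) →
    sum (λ j → sum (λ k → F (punchIn j k) (other j k))) ≈ sum (λ j → sum (F j))
  sum-other zero    F = refl
  sum-other (suc m) F = begin
    sum (λ k → F (suc k) zero) +
      sum (λ j → F zero j + sum (λ k → F (suc (punchIn j k)) (suc (other j k))))
      ≈⟨ +-congˡ (∑-distrib-+ (F zero) (λ j → sum (λ k → F (suc (punchIn j k)) (suc (other j k))))) ⟩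
    sum (λ k → F (suc k) zero) +
      (sum (F zero) + sum (λ j → sum (λ k → F (suc (punchIn j k)) (suc (other j k)))))
      ≈⟨ +-congˡ (+-congˡ (sum-other m (λ j k → F (suc j) (suc k)))) ⟩
    sum (λ k → F (suc k) zero) + (sum (F zero) + sum (λ j → sum (λ k → F (suc j) (suc k))))
      ≈⟨ x+[y+z]≈y+[x+z] (sum (λ k → F (suc k) zero)) (sum (F zero)) _ ⟩
    sum (F zero) + (sum (λ k → F (suc k) zero) + sum (λ j → sum (λ k → F (suc j) (suc k))))
      ≈⟨ +-congˡ (∑-distrib-+ (λ k → F (suc k) zero) (λ j → sum (λ k → F (suc j) (suc k)))) ⟨
    sum (F zero) + sum (λ j → sum (F (suc j))) ∎

  sum-neg : ∀ {n} (f : Fin n → Carrier) → sum (λ i → - f i) ≈ - sum f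
  sum-neg {zero}  f = sym -0#≈0#
  sum-neg {suc n} f = trans (+-congˡ (sum-neg (f ∘ suc))) (-‿+-comm (f zero) _)

  det-two-rows : ∀ n r s (R : Fin n → Fin (suc (suc n)) → Carrier) →
    det (suc (suc n)) (r ▹ s ▹ R) ≈
    sum (λ j → sum (λ k → sgn j * sgn k * (r j * s (punchIn j k) * det n (minor k (minor j R)))))
  det-two-rows n r s R = sum-cong-≋ λ j →
    trans (*-congˡ (*-distribˡ-sum (r j) (λ k → sgn k * (s (punchIn j k) * D j k))))
      (trans (*-distribˡ-sum (sgn j) (λ k → r j * (sgn k * (s (punchIn j k) * D j k))))
      (sum-cong-≋ λ k → lemma (sgn j) (r j) (sgn k) (s (punchIn j k)) (D j k)))
    where
    D = λ j k → det n (minor k (minor j R))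
    lemma : ∀ a b c d e → a * (b * (c * (d * e))) ≈ a * c * (b * d * e)
    lemma a b c d e = trans (*-congˡ (trans (x∙yz≈y∙xz b c (d * e)) (*-congˡ (sym (*-assoc b d e)))))
      (sym (*-assoc a c (b * d * e)))

  -- Expand both sides along two rows and reverse each pair of columns: the remaining minor is the
  -- same, the two entries trade places, and the sign flips by `sgn-other`.
  det-swap : ∀ n r s (R : Fin n → Fin (suc (suc n)) → Carrier) →
    det (suc (suc n)) (s ▹ r ▹ R) ≈ - det (suc (suc n)) (r ▹ s ▹ R)
  det-swap n r s R = begin
    det _ (s ▹ r ▹ R)
      ≈⟨ det-two-rows n s r R ⟩
    sum (λ j → sum (F s r j))
      ≈⟨ sum-other _ (F s r) ⟨
    sum (λ j → sum (λ k → F s r (punchIn j k) (other j k)))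
      ≈⟨ sum-cong-≋ (λ j → sum-cong-≋ (F-other j)) ⟩
    sum (λ j → sum (λ k → - F r s j k))
      ≈⟨ sum-cong-≋ (λ j → sum-neg (F r s j)) ⟩
    sum (λ j → - sum (F r s j))
      ≈⟨ sum-neg (λ j → sum (F r s j)) ⟩
    - sum (λ j → sum (F r s j))
      ≈⟨ -‿cong (det-two-rows n r s R) ⟨
    - det _ (r ▹ s ▹ R) ∎
    where
    F : ∀ r s j k → Carrier
    F r s j k = sgn j * sgn k * (r j * s (punchIn j k) * det n (minor k (minor j R)))
    lemma : ∀ a b c d → - a * (b * c * d) ≈ - (a * (c * b * d))
    lemma a b c d = trans (sym (-‿distribˡ-* a (b * c * d))) (-‿cong (*-congˡ (*-congʳ (*-comm b c))))
    F-other : ∀ j k → F s r (punchIn j k) (other j k) ≈ - F r s j k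
    F-other j k = trans
      (*-cong (sgn-other j k) (*-cong (*-congˡ (reflexive (≡.cong r (punchIn-other j k))))
        (det-cong n (λ i l → reflexive (≡.cong (R i) (punchIn-punchIn-other j k l))))))
      (lemma (sgn j * sgn k) (s (punchIn j k)) (r j) _)

  front : ∀ {n} {A : Set} → Fin (suc n) → (Fin (suc n) → A) → Fin (suc n) → A
  front v M = M v ▹ (M ∘ punchIn v)

  -- Row `suc v` is moved to just below row zero, by induction inside the minors of the expansion
  -- along row zero, and one exchange then brings it to the top.
  det-front : ∀ n v (M : Matrix (suc n)) → det (suc n) (front v M) ≈ sgn v * det (suc n) M
  det-front n       zero    M =
    trans (det-cong (suc n) {front zero M} {M} λ { zero j → refl ; (suc i) j → refl }) (sym (*-identityˡ _))
  det-front (suc n) (suc v) M = begin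
    det _ (front (suc v) M)
      ≈⟨ det-cong _ {front (suc v) M} {M (suc v) ▹ M zero ▹ rest}
           (λ { zero j → refl ; (suc zero) j → refl ; (suc (suc i)) j → refl }) ⟩
    det _ (M (suc v) ▹ M zero ▹ rest)
      ≈⟨ det-swap n (M zero) (M (suc v)) rest ⟩
    - det _ (M zero ▹ M (suc v) ▹ rest)
      ≈⟨ -‿cong (cofactors-cong (M zero) (M zero)
           (λ j → det (suc n) (minor j (M (suc v) ▹ rest))) (λ j → sgn v * det (suc n) (minor j (M ∘ suc)))
           (λ j → refl)
           λ j → trans (det-cong (suc n) {minor j (M (suc v) ▹ rest)} {front v (minor j (M ∘ suc))}
                         λ { zero k → refl ; (suc i) k → refl })
                       (det-front n v (minor j (M ∘ suc)))) ⟩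
    - cofactors (M zero) (λ j → sgn v * det (suc n) (minor j (M ∘ suc)))
      ≈⟨ -‿cong (cofactors-* (M zero) (λ j → det (suc n) (minor j (M ∘ suc))) (sgn v)) ⟩
    - (sgn v * det _ M)
      ≈⟨ -‿distribˡ-* (sgn v) (det _ M) ⟩
    - sgn v * det _ M ∎
    where
    rest : Fin n → Fin (suc (suc n)) → Carrier
    rest i = M (suc (punchIn v i))

  -- The copy of `r` is first moved to the second row. Exchanging two equal rows then gives only x =
  -- -x, which is where torsion-freeness enters.
  det-repeated : (∀ {x} → x ≈ - x → x ≈ 0#) →
    ∀ n (r : Fin (suc n) → Carrier) (R : Fin n → Fin (suc n) → Carrier) i → (∀ j → R i j ≈ r j) →
    det (suc n) (r ▹ R) ≈ 0#
  det-repeated torsion-free (suc n) r R i h = begin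
    det _ (r ▹ R)
      ≈⟨ cofactors-cong r r (λ j → det (suc n) (minor j R))
           (λ j → sgn i * det (suc n) (minor j (r ▹ R ∘ punchIn i))) (λ j → refl) minor≈ ⟩
    cofactors r (λ j → sgn i * det (suc n) (minor j (r ▹ R ∘ punchIn i)))
      ≈⟨ cofactors-* r (λ j → det (suc n) (minor j (r ▹ R ∘ punchIn i))) (sgn i) ⟩
    sgn i * det _ (r ▹ r ▹ R ∘ punchIn i)
      ≈⟨ *-congˡ (torsion-free (det-swap n r r (R ∘ punchIn i))) ⟩
    sgn i * 0#
      ≈⟨ zeroʳ (sgn i) ⟩
    0# ∎
    where
    minor≈ : ∀ j → det (suc n) (minor j R) ≈ sgn i * det (suc n) (minor j (r ▹ R ∘ punchIn i))
    minor≈ j = begin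
      det _ (minor j R)
        ≈⟨ *-identityˡ _ ⟨
      1# * det _ (minor j R)
        ≈⟨ *-congʳ (sgn*sgn i) ⟨
      sgn i * sgn i * det _ (minor j R)
        ≈⟨ *-assoc (sgn i) (sgn i) _ ⟩
      sgn i * (sgn i * det _ (minor j R))
        ≈⟨ *-congˡ (det-front n i (minor j R)) ⟨
      sgn i * det _ (front i (minor j R))
        ≈⟨ *-congˡ (det-cong (suc n) {front i (minor j R)} {minor j (r ▹ R ∘ punchIn i)}
             λ { zero k → h (punchIn j k) ; (suc _) k → refl }) ⟩
      sgn i * det _ (minor j (r ▹ R ∘ punchIn i)) ∎

  -- Up to the sign of `v` this is the matrix identity M adj(M) = det(M) I: pairing row `i` with the
  -- minors that omit row `v` is a determinant with a repeated row unless i = v.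
  cofactors-alien : (∀ {x} → x ≈ - x → x ≈ 0#) → ∀ n (M : Matrix (suc n)) v i →
    cofactors (M i) (λ j → det n (minor j (M ∘ punchIn v))) ≈
      (if does (v ≟ i) then sgn v else 0#) * det (suc n) M
  cofactors-alien torsion-free n M v i with v ≟ i
  ... | yes ≡.refl = det-front n v M
  ... | no v≢i = trans
    (det-repeated torsion-free n (M i) (M ∘ punchIn v) (punchOut v≢i)
      λ j → reflexive (≡.cong (λ k → M k j) (punchIn-punchOut v≢i)))
    (sym (zeroˡ (det (suc n) M)))

  sum-single : ∀ {n} (f : Fin n → Carrier) i → (∀ j → j ≢ i → f j ≈ 0#) → sum f ≈ f i
  sum-single {suc n} f i h = begin
    sum f                               ≈⟨ sum-remove {i = i} f ⟩
    f i + sum (λ j → f (punchIn i j))   ≈⟨ +-congˡ (sum-cong-≋ {x = λ j → f (punchIn i j)} {λ _ → 0#}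
                                             λ j → h (punchIn i j) (punchInᵢ≢i i j)) ⟩
    f i + sum {n} (λ j → 0#)            ≈⟨ +-congˡ (sum-replicate-zero n) ⟩
    f i + 0#                            ≈⟨ +-identityʳ (f i) ⟩
    f i ∎

  cofactors-single : ∀ {n} (r c : Fin n → Carrier) i → (∀ j → j ≢ i → r j ≈ 0#) →
    cofactors r c ≈ sgn i * (r i * c i)
  cofactors-single r c i h = sum-single (λ j → sgn j * (r j * c j)) i
    λ j j≢i → trans (*-congˡ (trans (*-congʳ (h j j≢i)) (zeroˡ (c j)))) (zeroʳ (sgn j))

  sum-δ : ∀ {n} (f : Fin n → Carrier) i x → sum (λ j → (if does (i ≟ j) then x else 0#) * f j) ≈ x * f i
  sum-δ f i x = trans (sum-single (λ j → (if does (i ≟ j) then x else 0#) * f j) i off) on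
    where
    off : ∀ j → j ≢ i → (if does (i ≟ j) then x else 0#) * f j ≈ 0#
    off j j≢i with i ≟ j
    ... | yes i≡j = contradiction (≡.sym i≡j) j≢i
    ... | no  _   = zeroˡ (f j)
    on : (if does (i ≟ i) then x else 0#) * f i ≈ x * f i
    on with i ≟ i
    ... | yes _   = refl
    ... | no i≢i = contradiction ≡.refl i≢i

  cofactors-char : ∀ {n} (A : Matrix n) i t (c : Fin n → Carrier) →
    cofactors (λ j → (if does (i ≟ j) then t else 0#) + - A i j) c ≈
    t * (sgn i * c i) + sum (λ j → - A i j * (sgn j * c j))
  cofactors-char A i t c = begin
    sum (λ j → sgn j * ((δ j + - A i j) * c j))
      ≈⟨ sum-cong-≋ {x = λ j → sgn j * ((δ j + - A i j) * c j)} {λ j → δ j * w j + - A i j * w j}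
           (λ j → trans (x∙yz≈y∙xz (sgn j) (δ j + - A i j) (c j)) (distribʳ (w j) (δ j) (- A i j))) ⟩
    sum (λ j → δ j * w j + - A i j * w j)
      ≈⟨ ∑-distrib-+ (λ j → δ j * w j) (λ j → - A i j * w j) ⟩
    sum (λ j → δ j * w j) + sum (λ j → - A i j * w j)
      ≈⟨ +-congʳ (sum-δ w i t) ⟩
    t * w i + sum (λ j → - A i j * w j) ∎
    where
    δ = λ j → if does (i ≟ j) then t else 0#
    w = λ j → sgn j * c j

  sum-symmetric : ∀ {n} (A : Matrix n) → (∀ i j → A i j ≈ A j i) → (x y : Fin n → Carrier) →
    sum (λ i → x i * sum (λ j → A i j * y j)) ≈ sum (λ j → y j * sum (λ i → A j i * x i))
  sum-symmetric A A-sym x y = begin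
    sum (λ i → x i * sum (λ j → A i j * y j))
      ≈⟨ sum-cong-≋ {x = λ i → x i * sum (λ j → A i j * y j)} {λ i → sum (λ j → x i * (A i j * y j))}
           (λ i → *-distribˡ-sum (x i) (λ j → A i j * y j)) ⟩
    sum (λ i → sum (λ j → x i * (A i j * y j)))
      ≈⟨ ∑-comm (λ i j → x i * (A i j * y j)) ⟩
    sum (λ j → sum (λ i → x i * (A i j * y j)))
      ≈⟨ sum-cong-≋ {x = λ j → sum (λ i → x i * (A i j * y j))} {λ j → y j * sum (λ i → A j i * x i)}
           (λ j → trans
             (sum-cong-≋ {x = λ i → x i * (A i j * y j)} {λ i → y j * (A j i * x i)} (rotate j))
             (sym (*-distribˡ-sum (y j) (λ i → A j i * x i)))) ⟩
    sum (λ j → y j * sum (λ i → A j i * x i)) ∎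
    where
    rotate : ∀ j i → x i * (A i j * y j) ≈ y j * (A j i * x i)
    rotate j i = begin
      x i * (A i j * y j)  ≈⟨ *-comm _ _ ⟩
      A i j * y j * x i    ≈⟨ *-congʳ (*-comm _ _) ⟩
      y j * A i j * x i    ≈⟨ *-assoc _ _ _ ⟩
      y j * (A i j * x i)  ≈⟨ *-congˡ (*-congʳ (A-sym i j)) ⟩
      y j * (A j i * x i)  ∎

-- The sign function local to det cannot be named, so unification has to supply it: the two
-- signatures ending in _ ≡ … are solved once _⊗_ and _⊕_ are abstracted, which makes the unfolded
-- determinant rigid. In expansion-sign₁ the with-abstraction over suc n separates the parameter of
-- that function from its index, as the induction in expansion-sign₂ needs.
module Expansion where

  open import Defs
  open import Data.Fin using (Fin; zero; suc; punchIn)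
  open import Data.Integer using (+_)
  open import Data.Nat using (zero; suc)
  open import Relation.Binary.PropositionalEquality using (_≡_; refl; cong; cong₂)

  sgnP : ∀ {m} → Fin m → Poly
  sgnP zero = const (+ 1)
  sgnP (suc j) = negP (sgnP j)

  sumFin-cong : ∀ {n} {f g : Fin n → Poly} → (∀ j → f j ≡ g j) → sumFin f ≡ sumFin g
  sumFin-cong {zero} h = refl
  sumFin-cong {suc n} h = cong₂ _⊕_ (h zero) (sumFin-cong (λ j → h (suc j)))

  mutual
    det-expand : ∀ n (M : Fin (suc n) → Fin (suc n) → Poly) →
      det (suc n) M ≡ sumFin (λ j → sgnP j ⊗ M zero j ⊗ det n (λ i k → M (suc i) (punchIn j k)))
    det-expand n M with _⊗_ | _⊕_
    ... | _·_ | _+′_ = cong₂ _+′_ refl (sumFin-cong (λ j →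
        cong (λ s → (s · M zero (suc j)) · det n (λ i k → M (suc i) (punchIn (suc j) k))) (expansion-sign₁ n M j)))

    expansion-sign₁ : ∀ n (M : Fin (suc n) → Fin (suc n) → Poly) (j : Fin n) → _ ≡ negP (sgnP j)
    expansion-sign₁ (suc n) M zero = refl
    expansion-sign₁ (suc n) M (suc j) with suc n
    ... | N = cong (λ p → negP (negP p)) (expansion-sign₂ N M n j)

    expansion-sign₂ : ∀ N (M : Fin (suc N) → Fin (suc N) → Poly) n (j : Fin n) → _ ≡ sgnP j
    expansion-sign₂ N M n zero = refl
    expansion-sign₂ N M (suc n) (suc j) = cong negP (expansion-sign₂ N M n j)

-- The function go local to nextFin is likewise supplied by unification. Equality is phrased as _≐_
-- because the with-abstraction in go₁ must not touch the index of the type of its two sides.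
module CyclicSuccessor where

  open import Defs
  open import Data.Fin using (Fin; zero; suc)
  open import Data.Nat using (zero; suc)
  open import Relation.Binary.PropositionalEquality using (_≡_; refl)

  lift : ∀ {m} → Fin (suc m) → Fin (suc (suc m))
  lift zero = zero
  lift (suc k) = suc (suc k)

  next : ∀ {m} → Fin (suc m) → Fin (suc m)
  next {zero} zero = zero
  next {suc m} zero = suc zero
  next {suc m} (suc j) = lift (next j)

  infix 4 _≐_
  _≐_ : {A : Set} → A → A → Set₁
  x ≐ y = ∀ (T : _ → Set) → T y → T x

  mutual
    nextFin≡next : ∀ m (j : Fin (suc m)) → nextFin j ≡ next j
    nextFin≡next zero zero = refl
    nextFin≡next (suc m) zero = refl
    nextFin≡next (suc m) (suc j) = go₁ m j (_≡ lift (next j)) refl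

    go₁ : ∀ m (j : Fin (suc m)) → _ ≐ lift (next j)
    go₁ m j T h with suc m | suc j | T (lift j)
    ... | P | I | _ = go₂ P I m j T h

    go₂ : ∀ P (I : Fin (suc P)) m (j : Fin (suc m)) → _ ≐ lift (next j)
    go₂ P I zero zero T h = h
    go₂ P I (suc m) zero T h = h
    go₂ P I (suc m) (suc j) T h rewrite go₂ P I m j (_≡ lift (next j)) refl with next j
    ... | zero = h
    ... | suc _ = h

module Nullity where

  open import Defs
  open import Data.Bool using (true; false; if_then_else_)
  open import Data.Nat as ℕ using (ℕ; zero; suc; z≤n; s≤s; _≤_; _<_; _∸_)
  import Data.Nat.Properties as ℕ
  open import Data.Fin as Fin using (Fin; zero; suc; punchIn; punchOut; opposite; _≟_)
  open import Data.Fin.Properties as Fin using (punchIn-punchOut; punchOut-injective; any?; injective⇒≤)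
  open import Data.Integer as ℤ using (ℤ; +_; -[1+_]; -_; _+_; _*_; ∣_∣)
  open import Data.Integer.Properties hiding (_≟_)
  open import Data.Integer.Tactic.RingSolver using (solve-∀)
  open import Data.List using (_∷_; [])
  open import Data.Product using (∃; _,_; proj₁; proj₂)
  open import Data.Sum using (inj₁; inj₂; [_,_]′)
  open import Function using (_∘_)
  open import Function.Definitions using (Injective)
  open import Relation.Binary.PropositionalEquality
  open import Relation.Nullary using (¬_; yes; no; does; contradiction)
  open Expansion
  open Determinant +-*-commutativeRing renaming (det to detℤ; det-cong to detℤ-cong)
  open import Algebra.Properties.Semiring.Sum (CommutativeRing.semiring +-*-commutativeRing)
  open import Data.Sign as Sign using (Sign)
  open import Data.Fin.Patterns
  open import Data.Vec using (lookup; []; _∷_)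
  open import Relation.Nullary.Decidable using (¬?)
  open import Relation.Binary.Definitions using (tri<; tri≈; tri>)

  private
    variable
      m n : ℕ

  -- Coefficients and evaluation of integer polynomials.

  coeff : Poly → ℕ → ℤ
  coeff []      k       = + 0
  coeff (a ∷ p) zero    = a
  coeff (a ∷ p) (suc k) = coeff p k

  coeff-⊕ : ∀ p q k → coeff (p ⊕ q) k ≡ coeff p k + coeff q k
  coeff-⊕ []      q       k       = sym (+-identityˡ _)
  coeff-⊕ (a ∷ p) []      k       = sym (+-identityʳ _)
  coeff-⊕ (a ∷ p) (b ∷ q) zero    = refl
  coeff-⊕ (a ∷ p) (b ∷ q) (suc k) = coeff-⊕ p q k

  coeff-scale : ∀ c p k → coeff (scale c p) k ≡ c * coeff p k
  coeff-scale c []      k       = sym (*-zeroʳ c)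
  coeff-scale c (a ∷ p) zero    = refl
  coeff-scale c (a ∷ p) (suc k) = coeff-scale c p k

  coeff-sumFin : ∀ {n} (f : Fin n → Poly) k → coeff (sumFin f) k ≡ sum (λ i → coeff (f i) k)
  coeff-sumFin {zero}  f k = refl
  coeff-sumFin {suc n} f k =
    trans (coeff-⊕ (f zero) _ k) (cong (λ x → coeff (f zero) k + x) (coeff-sumFin (f ∘ suc) k))

  mult0-coeff : ∀ p {k} → k < mult0 p → coeff p k ≡ + 0
  mult0-coeff (a ∷ p) {k} k<m with a ℤ.≟ + 0
  mult0-coeff (a ∷ p) {zero}  k<m       | yes a≡0 = a≡0
  mult0-coeff (a ∷ p) {suc k} (s≤s k<m) | yes a≡0 = mult0-coeff p k<m

  -- Coefficient lists obey the ring laws only up to trailing zeros. Polynomial identities are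
  -- therefore proved at every integer argument, where the determinant theory over ℤ applies.
  ev : Poly → ℤ → ℤ
  ev []      t = + 0
  ev (a ∷ p) t = a + t * ev p t

  ev-⊕ : ∀ p q t → ev (p ⊕ q) t ≡ ev p t + ev q t
  ev-⊕ []      q       t = sym (+-identityˡ _)
  ev-⊕ (a ∷ p) []      t = sym (+-identityʳ _)
  ev-⊕ (a ∷ p) (b ∷ q) t rewrite ev-⊕ p q t = lemma a b t (ev p t) (ev q t)
    where
    lemma : ∀ a b t x y → a + b + t * (x + y) ≡ a + t * x + (b + t * y)
    lemma = solve-∀

  ev-scale : ∀ c p t → ev (scale c p) t ≡ c * ev p t
  ev-scale c []      t = sym (*-zeroʳ c)
  ev-scale c (a ∷ p) t rewrite ev-scale c p t = lemma c a t (ev p t)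
    where
    lemma : ∀ c a t x → c * a + t * (c * x) ≡ c * (a + t * x)
    lemma = solve-∀

  ev-⊗ : ∀ p q t → ev (p ⊗ q) t ≡ ev p t * ev q t
  ev-⊗ []      q t = sym (*-zeroˡ (ev q t))
  ev-⊗ (a ∷ p) q t
    rewrite ev-⊕ (scale a q) (+ 0 ∷ p ⊗ q) t | ev-scale a q t | ev-⊗ p q t = lemma a t (ev p t) (ev q t)
    where
    lemma : ∀ a t x y → a * y + (+ 0 + t * (x * y)) ≡ (a + t * x) * y
    lemma = solve-∀

  ev-const : ∀ c t → ev (const c) t ≡ c
  ev-const c t = trans (cong (λ x → c + x) (*-zeroʳ t)) (+-identityʳ c)

  ev-sumFin : ∀ {n} (f : Fin n → Poly) t → ev (sumFin f) t ≡ sum (λ i → ev (f i) t)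
  ev-sumFin {zero}  f t = refl
  ev-sumFin {suc n} f t =
    trans (ev-⊕ (f zero) _ t) (cong (λ x → ev (f zero) t + x) (ev-sumFin (f ∘ suc) t))

  ev-sgnP : ∀ {n} (j : Fin n) t → ev (sgnP j) t ≡ sgn j
  ev-sgnP zero    t = ev-const (+ 1) t
  ev-sgnP (suc j) t = trans (ev-scale (- (+ 1)) (sgnP j) t)
    (trans (cong (λ x → - (+ 1) * x) (ev-sgnP j t)) (-1*i≡-i (sgn j)))

  ev-det : ∀ n M t → ev (det n M) t ≡ detℤ n (λ i j → ev (M i j) t)
  ev-det zero    M t = ev-const (+ 1) t
  ev-det (suc n) M t = begin
    ev (det (suc n) M) t
      ≡⟨ cong (λ p → ev p t) (det-expand n M) ⟩
    ev (sumFin (λ j → sgnP j ⊗ M zero j ⊗ D j)) t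
      ≡⟨ ev-sumFin (λ j → sgnP j ⊗ M zero j ⊗ D j) t ⟩
    sum (λ j → ev (sgnP j ⊗ M zero j ⊗ D j) t)
      ≡⟨ sum-cong-≗ {x = λ j → ev (sgnP j ⊗ M zero j ⊗ D j) t} {λ j → sgn j * (ev (M zero j) t * D′ j)} term ⟩
    detℤ (suc n) (λ i j → ev (M i j) t) ∎
    where
    open ≡-Reasoning
    D = λ j → det n (λ i k → M (suc i) (punchIn j k))
    D′ = λ j → detℤ n (λ i k → ev (M (suc i) (punchIn j k)) t)
    term : ∀ j → ev (sgnP j ⊗ M zero j ⊗ D j) t ≡ sgn j * (ev (M zero j) t * D′ j)
    term j
      rewrite ev-⊗ (sgnP j ⊗ M zero j) (D j) t | ev-⊗ (sgnP j) (M zero j) t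
            | ev-sgnP j t | ev-det n (λ i k → M (suc i) (punchIn j k)) t
      = *-assoc (sgn j) (ev (M zero j) t) (D′ j)

  -- The constant coefficient a is divisible by 1 + |a|, so it vanishes and can be stripped.
  ev≡0⇒coeff≡0 : ∀ p → (∀ t → t ≢ + 0 → ev p t ≡ + 0) → ∀ k → coeff p k ≡ + 0
  ev≡0⇒coeff≡0 []      h k = refl
  ev≡0⇒coeff≡0 (a ∷ p) h = λ
    { zero    → a≡0
    ; (suc k) → ev≡0⇒coeff≡0 p (λ t t≢0 →
        [ (λ t≡0 → contradiction t≡0 t≢0) , (λ e → e) ]′ (i*j≡0⇒i≡0∨j≡0 t (t*ev≡0 t t≢0))) k
    }
    where
    s = + suc ∣ a ∣
    ∣a∣ : ∣ a ∣ ≡ suc ∣ a ∣ ℕ.* ∣ ev p s ∣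
    ∣a∣ = begin
      ∣ a ∣            ≡⟨ cong ∣_∣ (lemma a (s * ev p s)) ⟩
      ∣ a + s * ev p s + - (s * ev p s) ∣  ≡⟨ cong (λ x → ∣ x + - (s * ev p s) ∣) (h s (λ ())) ⟩
      ∣ + 0 + - (s * ev p s) ∣   ≡⟨ cong ∣_∣ (+-identityˡ (- (s * ev p s))) ⟩
      ∣ - (s * ev p s) ∣   ≡⟨ ∣-i∣≡∣i∣ (s * ev p s) ⟩
      ∣ s * ev p s ∣     ≡⟨ abs-* s (ev p s) ⟩
      suc ∣ a ∣ ℕ.* ∣ ev p s ∣ ∎
      where
      open ≡-Reasoning
      lemma : ∀ a x → a ≡ a + x + - x
      lemma = solve-∀
    small : ∀ x y → x ≡ suc x ℕ.* y → x ≡ 0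
    small x zero    e = trans e (ℕ.*-zeroʳ x)
    small x (suc y) e = contradiction (ℕ.≤-trans (ℕ.m≤m*n (suc x) (suc y)) (ℕ.≤-reflexive (sym e))) ℕ.1+n≰n
    a≡0 : a ≡ + 0
    a≡0 = ∣i∣≡0⇒i≡0 (small ∣ a ∣ ∣ ev p s ∣ ∣a∣)
    t*ev≡0 : ∀ t → t ≢ + 0 → t * ev p t ≡ + 0
    t*ev≡0 t t≢0 = trans (sym (+-identityˡ (t * ev p t))) (trans (cong (λ x → x + t * ev p t) (sym a≡0)) (h t t≢0))

  ev≡⇒coeff≡ : ∀ p q → (∀ t → ev p t ≡ ev q t) → ∀ k → coeff p k ≡ coeff q k
  ev≡⇒coeff≡ p q h k = i-j≡0⇒i≡j (coeff p k) (coeff q k) (begin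
    coeff p k + - coeff q k                   ≡⟨ cong (λ x → coeff p k + x) (-1*i≡-i (coeff q k)) ⟨
    coeff p k + - (+ 1) * coeff q k           ≡⟨ cong (λ x → coeff p k + x) (coeff-scale (- (+ 1)) q k) ⟨
    coeff p k + coeff (negP q) k              ≡⟨ coeff-⊕ p (negP q) k ⟨
    coeff (p ⊕ negP q) k                      ≡⟨ ev≡0⇒coeff≡0 (p ⊕ negP q) vanishes k ⟩
    + 0                                       ∎)
    where
    open ≡-Reasoning
    vanishes : ∀ t → t ≢ + 0 → ev (p ⊕ negP q) t ≡ + 0
    vanishes t _ rewrite ev-⊕ p (negP q) t | ev-scale (- (+ 1)) q t | -1*i≡-i (ev q t) | h t = +-inverseʳ (ev q t)

  -- Characteristic polynomials and deletion of a row and column.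

  charMatrix : ∀ {n} → Matrix n → Fin n → Fin n → Poly
  charMatrix A i j = (if does (i ≟ j) then X else []) ⊕ negP (const (A i j))

  -- `charPoly Γ` is by definition `φ (adjMatrix Γ)`; arbitrary matrices are allowed so that rows
  -- and columns can be deleted.
  φ : ∀ {n} → Matrix n → Poly
  φ {n} A = det n (charMatrix A)

  ev-charMatrix : ∀ {n} (A : Matrix n) t i j →
    ev (charMatrix A i j) t ≡ (if does (i ≟ j) then t else + 0) + - A i j
  ev-charMatrix A t i j with does (i ≟ j)
  ... | true  = lemma t (A i j)
    where
    lemma : ∀ t a → + 0 + - (+ 1) * a + t * (+ 1 + t * + 0) ≡ t + - a
    lemma = solve-∀
  ... | false = lemma t (A i j)
    where
    lemma : ∀ t a → - (+ 1) * a + t * + 0 ≡ + 0 + - a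
    lemma = solve-∀

  delete : ∀ {n} → Fin (suc n) → Matrix (suc n) → Matrix n
  delete v A i j = A (punchIn v i) (punchIn v j)

  ev-φ-delete : ∀ {n} (A : Matrix (suc n)) v t →
    ev (φ (delete v A)) t ≡ detℤ n (minor v (λ i j → ev (charMatrix A (punchIn v i) j) t))
  ev-φ-delete {n} A v t = trans (ev-det n (charMatrix (delete v A)) t) (detℤ-cong n entry)
    where
    entry : ∀ i j → ev (charMatrix (delete v A) i j) t ≡ ev (charMatrix A (punchIn v i) (punchIn v j)) t
    entry i j = trans (ev-charMatrix (delete v A) t i j)
      (trans (cong (λ b → (if b then t else + 0) + - delete v A i j) (same i j))
      (sym (ev-charMatrix A t (punchIn v i) (punchIn v j))))
      where
      same : ∀ i j → does (i ≟ j) ≡ does (punchIn v i ≟ punchIn v j)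
      same i j with i ≟ j | punchIn v i ≟ punchIn v j
      ... | yes _   | yes _ = refl
      ... | no  _   | no  _ = refl
      ... | yes i≡j | no ≢  = contradiction (cong (punchIn v) i≡j) ≢
      ... | no  i≢j | yes ≡ = contradiction (Fin.punchIn-injective v i j ≡) i≢j

  -- Order of vanishing of the characteristic polynomial under vertex deletion.

  i≡-i⇒i≡0 : ∀ {i} → i ≡ - i → i ≡ + 0
  i≡-i⇒i≡0 {+ zero} _ = refl

  0≤i*i : ∀ i → + 0 ℤ.≤ i * i
  0≤i*i (+ n)    = subst (+ 0 ℤ.≤_) (pos-* n n) (ℤ.+≤+ z≤n)
  0≤i*i -[1+ n ] = ℤ.+≤+ z≤n

  sum-squares-nonneg : ∀ {n} (f : Fin n → ℤ) → + 0 ℤ.≤ sum (λ i → f i * f i)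
  sum-squares-nonneg {zero}  f = ≤-refl
  sum-squares-nonneg {suc n} f = +-mono-≤ (0≤i*i (f zero)) (sum-squares-nonneg (f ∘ suc))

  sum-squares≡0 : ∀ {n} (f : Fin n → ℤ) → sum (λ i → f i * f i) ≡ + 0 → ∀ i → f i ≡ + 0
  sum-squares≡0 {suc n} f s≡0 = λ
    { zero    → [ (λ e → e) , (λ e → e) ]′ (i*j≡0⇒i≡0∨j≡0 (f zero) f₀²≡0)
    ; (suc i) → sum-squares≡0 (f ∘ suc) rest≡0 i
    }
    where
    f₀² = f zero * f zero
    rest = sum (λ i → f (suc i) * f (suc i))
    f₀²≡0 : f₀² ≡ + 0
    f₀²≡0 = ≤-antisym (≤-trans (≤-reflexive (sym (+-identityʳ f₀²)))
      (≤-trans (+-monoʳ-≤ f₀² (sum-squares-nonneg (f ∘ suc))) (≤-reflexive s≡0))) (0≤i*i (f zero))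
    rest≡0 : rest ≡ + 0
    rest≡0 = trans (sym (+-identityˡ rest)) (trans (cong (λ x → x + rest) (sym f₀²≡0)) s≡0)

  sum-neg* : ∀ {n} (a w : Fin n → ℤ) → sum (λ j → - a j * w j) ≡ - sum (λ j → a j * w j)
  sum-neg* {zero}  a w = refl
  sum-neg* {suc n} a w = trans
    (cong₂ _+_ (sym (neg-distribˡ-* (a zero) (w zero))) (sum-neg* (a ∘ suc) (w ∘ suc)))
    (sym (neg-distrib-+ (a zero * w zero) _))

  -- Divisibility by x^(d+1): the bound on the index is inclusive.
  VanishesTo : ℕ → Poly → Set
  VanishesTo d p = ∀ {k} → k ≤ d → coeff p k ≡ + 0

  -- The polynomial in the hypothesis is component i of (xI - A)u. One order of vanishing is lost in
  -- passing to u.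
  resolvent-vanishes : ∀ {n} (A : Matrix n) → (∀ i j → A i j ≡ A j i) → (u : Fin n → Poly) → ∀ d →
    (∀ i → VanishesTo (suc d) ((+ 0 ∷ u i) ⊕ sumFin (λ j → scale (- A i j) (u j)))) →
    ∀ i → VanishesTo d (u i)
  resolvent-vanishes {n} A A-sym u d h i {k} = vanish k i
    where
    A·u : ∀ i k → coeff (+ 0 ∷ u i) k + - sum (λ j → A i j * coeff (u j) k) ≡
      coeff ((+ 0 ∷ u i) ⊕ sumFin (λ j → scale (- A i j) (u j))) k
    A·u i k = sym (trans (coeff-⊕ (+ 0 ∷ u i) (sumFin (λ j → scale (- A i j) (u j))) k)
      (cong (λ x → coeff (+ 0 ∷ u i) k + x)
      (trans (coeff-sumFin (λ j → scale (- A i j) (u j)) k)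
      (trans (sum-cong-≗ {x = λ j → coeff (scale (- A i j) (u j)) k} {λ j → - A i j * coeff (u j) k}
               (λ j → coeff-scale (- A i j) (u j) k))
             (sum-neg* (A i) (λ j → coeff (u j) k))))))

    shift : ∀ i {k} → k ≤ suc d → coeff (+ 0 ∷ u i) k ≡ sum (λ j → A i j * coeff (u j) k)
    shift i {k} k≤d = i-j≡0⇒i≡j _ _ (trans (A·u i k) (h i k≤d))

    -- `below` is the induction hypothesis u⁽ᵏ⁻¹⁾ = 0; the prepended zero coefficient makes it true
    -- at k = 0.
    below : ∀ k → k ≤ d → ∀ i → coeff (+ 0 ∷ u i) k ≡ + 0
    vanish : ∀ k i → k ≤ d → coeff (u i) k ≡ + 0

    below zero    k≤d i = refl
    below (suc k) k≤d i = vanish k i (ℕ.<⇒≤ k≤d)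

    -- One factor is replaced by A u⁽ᵏ⁺¹⁾, which uses the hypothesis at index k + 1 ≤ d + 1. By
    -- symmetry A moves to the other factor, and A u⁽ᵏ⁾ = u⁽ᵏ⁻¹⁾ = 0.
    vanish k i k≤d = sum-squares≡0 (λ i → coeff (u i) k) (begin
      sum (λ i → coeff (u i) k * coeff (u i) k)
        ≡⟨ sum-cong-≗ {x = λ i → coeff (u i) k * coeff (u i) k}
             {λ i → coeff (u i) k * sum (λ j → A i j * coeff (u j) (suc k))}
             (λ i → cong (λ x → coeff (u i) k * x) (shift i (s≤s k≤d))) ⟩
      sum (λ i → coeff (u i) k * sum (λ j → A i j * coeff (u j) (suc k)))
        ≡⟨ sum-symmetric A A-sym (λ i → coeff (u i) k) (λ j → coeff (u j) (suc k)) ⟩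
      sum (λ j → coeff (u j) (suc k) * sum (λ i → A j i * coeff (u i) k))
        ≡⟨ sum-cong-≗ {x = λ j → coeff (u j) (suc k) * sum (λ i → A j i * coeff (u i) k)} {λ _ → + 0}
             (λ j → trans (cong (λ x → coeff (u j) (suc k) * x)
                            (trans (sym (shift j (ℕ.m≤n⇒m≤1+n k≤d))) (below k k≤d j)))
                          (*-zeroʳ (coeff (u j) (suc k)))) ⟩
      sum {n} (λ j → + 0)
        ≡⟨ sum-replicate-zero n ⟩
      + 0 ∎) i
      where open ≡-Reasoning

  delete-vanishes : ∀ {n} (A : Matrix (suc n)) → (∀ i j → A i j ≡ A j i) → ∀ v d →
    VanishesTo (suc d) (φ A) → VanishesTo d (φ (delete v A))
  delete-vanishes {n} A A-sym v d h {k} k≤d = begin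
    coeff (φ (delete v A)) k
      ≡⟨ ev≡⇒coeff≡ (φ (delete v A)) (scale (sgn v) (u v)) ev-u k ⟩
    coeff (scale (sgn v) (u v)) k
      ≡⟨ coeff-scale (sgn v) (u v) k ⟩
    sgn v * coeff (u v) k
      ≡⟨ cong (λ x → sgn v * x) (resolvent-vanishes A A-sym u d f-vanishes v k≤d) ⟩
    sgn v * + 0
      ≡⟨ *-zeroʳ (sgn v) ⟩
    + 0 ∎
    where
    open ≡-Reasoning
    rows : ∀ t → Fin n → Fin (suc n) → ℤ
    rows t i j = ev (charMatrix A (punchIn v i) j) t
    c : ∀ t → Fin (suc n) → ℤ
    c t j = detℤ n (minor j (rows t))
    C : Fin (suc n) → Poly
    C j = det n (λ a b → charMatrix A (punchIn v a) (punchIn j b))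
    -- Up to the factor `sgn v`, the v-th column of the adjugate of xI - A.
    u : Fin (suc n) → Poly
    u j = scale (sgn j) (C j)
    u≡ : ∀ t j → ev (u j) t ≡ sgn j * c t j
    u≡ t j = trans (ev-scale (sgn j) (C j) t)
      (cong (λ x → sgn j * x) (ev-det n (λ a b → charMatrix A (punchIn v a) (punchIn j b)) t))
    ev-u : ∀ t → ev (φ (delete v A)) t ≡ ev (scale (sgn v) (u v)) t
    ev-u t = begin
      ev (φ (delete v A)) t      ≡⟨ ev-φ-delete A v t ⟩
      c t v                      ≡⟨ *-identityˡ (c t v) ⟨
      + 1 * c t v                ≡⟨ cong (λ x → x * c t v) (sgn*sgn v) ⟨
      sgn v * sgn v * c t v      ≡⟨ *-assoc (sgn v) (sgn v) (c t v) ⟩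
      sgn v * (sgn v * c t v)    ≡⟨ cong (λ x → sgn v * x) (u≡ t v) ⟨
      sgn v * ev (u v) t         ≡⟨ ev-scale (sgn v) (u v) t ⟨
      ev (scale (sgn v) (u v)) t ∎
    -- `f` is (xI - A)u. By the alien cofactor identity it equals `sgn v` times φ in component `v`
    -- and zero elsewhere, which `e` records.
    f : Fin (suc n) → Poly
    f i = (+ 0 ∷ u i) ⊕ sumFin (λ j → scale (- A i j) (u j))
    e : Fin (suc n) → ℤ
    e i = if does (v ≟ i) then sgn v else + 0
    ev-f : ∀ i t → ev (f i) t ≡ ev (scale (e i) (φ A)) t
    ev-f i t = begin
      ev (f i) t
        ≡⟨ ev-⊕ (+ 0 ∷ u i) (sumFin (λ j → scale (- A i j) (u j))) t ⟩
      ev (+ 0 ∷ u i) t + ev (sumFin (λ j → scale (- A i j) (u j))) t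
        ≡⟨ cong₂ _+_ (trans (+-identityˡ (t * ev (u i) t)) (cong (λ x → t * x) (u≡ t i)))
             (trans (ev-sumFin (λ j → scale (- A i j) (u j)) t)
               (sum-cong-≗ {x = λ j → ev (scale (- A i j) (u j)) t} {λ j → - A i j * (sgn j * c t j)}
                 (λ j → trans (ev-scale (- A i j) (u j) t) (cong (λ x → - A i j * x) (u≡ t j))))) ⟩
      t * (sgn i * c t i) + sum (λ j → - A i j * (sgn j * c t j))
        ≡⟨ cofactors-char A i t (c t) ⟨
      cofactors (λ j → (if does (i ≟ j) then t else + 0) + - A i j) (c t)
        ≡⟨ cofactors-cong (λ j → ev (charMatrix A i j) t)
             (λ j → (if does (i ≟ j) then t else + 0) + - A i j) (c t) (c t)
             (ev-charMatrix A t i) (λ _ → refl) ⟨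
      cofactors (λ j → ev (charMatrix A i j) t) (c t)
        ≡⟨ cofactors-alien i≡-i⇒i≡0 n (λ i j → ev (charMatrix A i j) t) v i ⟩
      e i * detℤ (suc n) (λ i j → ev (charMatrix A i j) t)
        ≡⟨ cong (λ x → e i * x) (ev-det (suc n) (charMatrix A) t) ⟨
      e i * ev (φ A) t
        ≡⟨ ev-scale (e i) (φ A) t ⟨
      ev (scale (e i) (φ A)) t ∎
    f-vanishes : ∀ i → VanishesTo (suc d) (f i)
    f-vanishes i {k} k≤1+d = trans (ev≡⇒coeff≡ (f i) (scale (e i) (φ A)) (ev-f i) k)
      (trans (coeff-scale (e i) (φ A) k) (trans (cong (λ x → e i * x) (h k≤1+d)) (*-zeroʳ (e i))))

  -- Determinants that are triangular after permuting rows and columns.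

  injective⇒onto : (f : Fin m → Fin m) → Injective _≡_ _≡_ f → ∀ j → ∃ λ s → f s ≡ j
  injective⇒onto {suc m} f f-inj j with any? (λ s → f s ≟ j)
  ... | yes onto = onto
  ... | no  ∄s   = contradiction
    (injective⇒≤ {f = λ s → punchOut (j≢f s)}
      λ {s} {s′} e → f-inj (punchOut-injective (j≢f s) (j≢f s′) e))
    ℕ.1+n≰n
    where
    j≢f : ∀ s → j ≢ f s
    j≢f s j≡fs = ∄s (s , sym j≡fs)

  missed : m < n → (f : Fin m → Fin n) → ∃ λ v → ∀ s → v ≢ f s
  missed {m} {n} m<n f with any? (λ v → Fin.all? (λ s → ¬? (v ≟ f s)))
  ... | yes found = found
  ... | no  none  = contradiction (injective⇒≤ {f = g} g-inj) (ℕ.<⇒≱ m<n)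
    where
    hit : ∀ v → ∃ λ s → v ≡ f s
    hit v with any? (λ s → v ≟ f s)
    ... | yes h = h
    ... | no ¬h = contradiction (v , λ s e → ¬h (s , e)) none
    g : Fin n → Fin m
    g v = proj₁ (hit v)
    g-inj : Injective _≡_ _≡_ g
    g-inj {v} {w} e = trans (proj₂ (hit v)) (trans (cong f e) (sym (proj₂ (hit w))))

  sgn≢0 : (j : Fin n) → sgn j ≢ + 0
  sgn≢0 j e with trans (sym (sgn*sgn j)) (cong (λ x → x * sgn j) e)
  ... | ()

  -- With rows in the order `p` and columns in the order `q` the matrix is lower triangular. Row
  -- `p zero` is brought to the top, where only the entry in column `q zero` survives, and the minor
  -- is again of this form.
  det≢0 : (M : Matrix n) (p q : Fin n → Fin n) → Injective _≡_ _≡_ p → Injective _≡_ _≡_ q →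
    (∀ {s s′} → s Fin.< s′ → M (p s) (q s′) ≡ + 0) → (∀ s → M (p s) (q s) ≢ + 0) → detℤ n M ≢ + 0
  det≢0 {zero}  M p q p-inj q-inj upper diag = λ ()
  det≢0 {suc n} M p q p-inj q-inj upper diag det≡0 =
    [ sgn≢0 (q zero) , (λ e → [ diag zero , minor≢0 ]′ (i*j≡0⇒i≡0∨j≡0 (M (p zero) (q zero)) e)) ]′
      (i*j≡0⇒i≡0∨j≡0 (sgn (q zero)) product≡0)
    where
    p₀≢ : ∀ s → p zero ≢ p (suc s)
    p₀≢ s e with p-inj e
    ... | ()
    q₀≢ : ∀ s → q zero ≢ q (suc s)
    q₀≢ s e with q-inj e
    ... | ()
    D : Fin (suc n) → ℤ
    D j = detℤ n (minor j (M ∘ punchIn (p zero)))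
    off : ∀ j → j ≢ q zero → M (p zero) j ≡ + 0
    off j j≢q₀ with injective⇒onto q q-inj j
    ... | zero  , e = contradiction (sym e) j≢q₀
    ... | suc s , e = trans (cong (M (p zero)) (sym e)) (upper (s≤s z≤n))
    product≡0 : sgn (q zero) * (M (p zero) (q zero) * D (q zero)) ≡ + 0
    product≡0 = begin
      sgn (q zero) * (M (p zero) (q zero) * D (q zero)) ≡⟨ cofactors-single (M (p zero)) D (q zero) off ⟨
      cofactors (M (p zero)) D                          ≡⟨ det-front n (p zero) M ⟩
      sgn (p zero) * detℤ (suc n) M                     ≡⟨ cong (λ x → sgn (p zero) * x) det≡0 ⟩
      sgn (p zero) * + 0                                ≡⟨ *-zeroʳ (sgn (p zero)) ⟩
      + 0 ∎
      where open ≡-Reasoning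
    row : ∀ s → punchIn (p zero) (punchOut (p₀≢ s)) ≡ p (suc s)
    row s = punchIn-punchOut (p₀≢ s)
    col : ∀ s → punchIn (q zero) (punchOut (q₀≢ s)) ≡ q (suc s)
    col s = punchIn-punchOut (q₀≢ s)
    minor≢0 : D (q zero) ≢ + 0
    minor≢0 = det≢0 (minor (q zero) (M ∘ punchIn (p zero)))
      (λ s → punchOut (p₀≢ s)) (λ s → punchOut (q₀≢ s))
      (λ {s} {s′} e → Fin.suc-injective (p-inj (punchOut-injective (p₀≢ s) (p₀≢ s′) e)))
      (λ {s} {s′} e → Fin.suc-injective (q-inj (punchOut-injective (q₀≢ s) (q₀≢ s′) e)))
      (λ {s} {s′} s<s′ → trans (cong₂ M (row s) (col s′)) (upper (s≤s s<s′)))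
      (λ s → subst (_≢ + 0) (sym (cong₂ M (row s) (col s))) (diag (suc s)))

  ev-0 : ∀ p → ev p (+ 0) ≡ coeff p 0
  ev-0 []      = refl
  ev-0 (a ∷ p) = trans (cong (λ x → a + x) (*-zeroˡ (ev p (+ 0)))) (+-identityʳ a)

  -- Induction on the number `d` of indices to be discarded: deleting one outside the image of `p`
  -- costs one order of vanishing. At d = 0 the constant coefficient is det(-A), nonzero by
  -- triangularity.
  triangular⇒¬vanishes : ∀ d {n r} → n ≡ d ℕ.+ r → (A : Matrix n) → (∀ i j → A i j ≡ A j i) →
    (p : Fin r → Fin n) (π : Fin r → Fin r) → Injective _≡_ _≡_ p → Injective _≡_ _≡_ π →
    (∀ {s s′} → s Fin.< s′ → A (p s) (p (π s′)) ≡ + 0) → (∀ s → A (p s) (p (π s)) ≢ + 0) →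
    ¬ VanishesTo d (φ A)
  triangular⇒¬vanishes zero {n} refl A A-sym p π p-inj π-inj upper diag vanishes =
    det≢0 M p (p ∘ π) p-inj (π-inj ∘ p-inj)
      (λ {s} {s′} s<s′ → trans (M≡-A (p s) (p (π s′))) (cong -_ (upper s<s′)))
      (λ s e → diag s (trans (sym (neg-involutive (A (p s) (p (π s)))))
                            (cong -_ (trans (sym (M≡-A (p s) (p (π s)))) e))))
      (trans (sym (ev-det n (charMatrix A) (+ 0))) (trans (ev-0 (φ A)) (vanishes z≤n)))
    where
    M : Matrix n
    M i j = ev (charMatrix A i j) (+ 0)
    M≡-A : ∀ i j → M i j ≡ - A i j
    M≡-A i j = trans (ev-charMatrix A (+ 0) i j)
      (trans (cong (λ x → x + - A i j) (if-same (does (i ≟ j)))) (+-identityˡ (- A i j)))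
      where
      if-same : ∀ b → (if b then + 0 else + 0) ≡ + 0
      if-same true  = refl
      if-same false = refl
  triangular⇒¬vanishes (suc d) {r = r} refl A A-sym p π p-inj π-inj upper diag vanishes
    with v , v∉p ← missed (ℕ.m<n+m r (s≤s z≤n)) p =
    triangular⇒¬vanishes d refl (delete v A) (λ i j → A-sym (punchIn v i) (punchIn v j))
      (λ s → punchOut (v∉p s)) π
      (λ {s} {s′} e → p-inj (punchOut-injective (v∉p s) (v∉p s′) e)) π-inj
      (λ {s} {s′} s<s′ → trans (entry s s′) (upper s<s′))
      (λ s e → diag s (trans (sym (entry s s)) e))
      (delete-vanishes A A-sym v d vanishes)
    where
    entry : ∀ s s′ → delete v A (punchOut (v∉p s)) (punchOut (v∉p (π s′))) ≡ A (p s) (p (π s′))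
    entry s s′ = cong₂ A (punchIn-punchOut (v∉p s)) (punchIn-punchOut (v∉p (π s′)))

  -- Pendant matchings and the nullity bound.

  record PendantMatching (G : Graph n) : Set where
    field
      x₁ y₁ x₂ y₂ x₃ y₃ : Fin n
      x₁y₁ : adj G x₁ y₁ ≡ true
      x₂y₂ : adj G x₂ y₂ ≡ true
      x₃y₃ : adj G x₃ y₃ ≡ true
      x₁x₂ : adj G x₁ x₂ ≡ false
      x₁y₂ : adj G x₁ y₂ ≡ false
      x₁x₃ : adj G x₁ x₃ ≡ false
      x₁y₃ : adj G x₁ y₃ ≡ false
      x₂x₃ : adj G x₂ x₃ ≡ false
      x₂y₃ : adj G x₂ y₃ ≡ false

  adjMatrix-sym : (Γ : SignedGraph n) → ∀ i j → adjMatrix Γ i j ≡ adjMatrix Γ j i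
  adjMatrix-sym Γ i j = cong₂ (λ b s → if b then signℤ s else + 0) (adj-sym (graph Γ) i j) (sign-sym Γ i j)

  adjMatrix≡0 : (Γ : SignedGraph n) → ∀ {i j} → adj (graph Γ) i j ≡ false → adjMatrix Γ i j ≡ + 0
  adjMatrix≡0 Γ {i} {j} ij = cong (λ b → if b then signℤ (sign Γ i j) else + 0) ij

  adjMatrix≢0 : (Γ : SignedGraph n) → ∀ {i j} → adj (graph Γ) i j ≡ true → adjMatrix Γ i j ≢ + 0
  adjMatrix≢0 Γ {i} {j} ij e with adj (graph Γ) i j | sign Γ i j
  adjMatrix≢0 Γ refl () | true | Sign.+
  adjMatrix≢0 Γ refl () | true | Sign.-

  -- If the bound failed, the coefficients 0 to n - 6 would all vanish, although only n - 6 vertices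
  -- lie outside the matching.
  pendantMatching⇒η≤ : (Γ : SignedGraph n) → 6 ≤ n → PendantMatching (graph Γ) → η Γ ≤ n ∸ 6
  pendantMatching⇒η≤ {n} Γ 6≤n P = ℕ.≮⇒≥ λ n∸6<η →
    triangular⇒¬vanishes (n ∸ 6) (sym (ℕ.m∸n+n≡m 6≤n)) (adjMatrix Γ) (adjMatrix-sym Γ) p opposite
      p-inj
      (λ {s} {s′} e → trans (sym (Fin.opposite-involutive s)) (trans (cong opposite e) (Fin.opposite-involutive s′)))
      (λ {s} {s′} s<s′ → adjMatrix≡0 Γ (upper s s′ s<s′)) (λ s → adjMatrix≢0 Γ (diag s))
      (λ k≤ → mult0-coeff (charPoly Γ) (ℕ.≤-<-trans k≤ n∸6<η))
    where
    open PendantMatching P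
    G = graph Γ
    p : Fin 6 → Fin n
    -- Partners sit at mirror positions, so reading the columns through `opposite` puts the matching
    -- edges on the diagonal. Adjacencies among the y's, and of an earlier y with a later x, fall
    -- below the diagonal.
    p = lookup (x₁ ∷ x₂ ∷ x₃ ∷ y₃ ∷ y₂ ∷ y₁ ∷ [])

    flip-adj : ∀ {i j b} → adj G i j ≡ b → adj G j i ≡ b
    flip-adj {i} {j} e = trans (adj-sym G j i) e

    diag : ∀ s → adj G (p s) (p (opposite s)) ≡ true
    diag 0F = x₁y₁
    diag 1F = x₂y₂
    diag 2F = x₃y₃
    diag 3F = flip-adj x₃y₃
    diag 4F = flip-adj x₂y₂
    diag 5F = flip-adj x₁y₁

    upper : ∀ s s′ → s Fin.< s′ → adj G (p s) (p (opposite s′)) ≡ false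
    upper 0F 1F _ = x₁y₂
    upper 0F 2F _ = x₁y₃
    upper 0F 3F _ = x₁x₃
    upper 0F 4F _ = x₁x₂
    upper 0F 5F _ = adj-irr G x₁
    upper 1F 2F _ = x₂y₃
    upper 1F 3F _ = x₂x₃
    upper 1F 4F _ = adj-irr G x₂
    upper 1F 5F _ = flip-adj x₁x₂
    upper 2F 3F _ = adj-irr G x₃
    upper 2F 4F _ = flip-adj x₂x₃
    upper 2F 5F _ = flip-adj x₁x₃
    upper 3F 4F _ = flip-adj x₂y₃
    upper 3F 5F _ = flip-adj x₁y₃
    upper 4F 5F _ = flip-adj x₁y₂
    upper 1F 1F (s≤s ())
    upper 2F 1F (s≤s ())
    upper 2F 2F (s≤s (s≤s ()))
    upper 3F 1F (s≤s ())
    upper 3F 2F (s≤s (s≤s ()))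
    upper 3F 3F (s≤s (s≤s (s≤s ())))
    upper 4F 1F (s≤s ())
    upper 4F 2F (s≤s (s≤s ()))
    upper 4F 3F (s≤s (s≤s (s≤s ())))
    upper 4F 4F (s≤s (s≤s (s≤s (s≤s ()))))
    upper 5F 1F (s≤s ())
    upper 5F 2F (s≤s (s≤s ()))
    upper 5F 3F (s≤s (s≤s (s≤s ())))
    upper 5F 4F (s≤s (s≤s (s≤s (s≤s ()))))
    upper 5F 5F (s≤s (s≤s (s≤s (s≤s (s≤s ())))))

    -- Column s′ meets row s′ in an edge and row s in a non-edge, so the two vertices differ.
    distinct : ∀ {s s′} → s Fin.< s′ → p s ≢ p s′
    distinct {s} {s′} s<s′ e = contradiction
      (trans (sym (diag s′)) (trans (cong (λ v → adj G v (p (opposite s′))) (sym e)) (upper s s′ s<s′))) λ ()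

    p-inj : Injective _≡_ _≡_ p
    p-inj {s} {s′} e with Fin.<-cmp s s′
    ... | tri< s<s′ _ _ = contradiction e (distinct s<s′)
    ... | tri≈ _ s≡s′ _ = s≡s′
    ... | tri> _ _ s′<s = contradiction (sym e) (distinct s′<s)

open import Defs
open Nullity
open CyclicSuccessor
open import Data.Bool using (Bool; true; false; _∧_; not)
open import Data.Bool.Properties using (T-≡; ∧-identityʳ; ∧-zeroʳ; ¬-not)
open import Data.Fin using (Fin; zero; suc; toℕ; _≟_)
open import Data.Fin.Properties using (toℕ-injective; toℕ<n)
open import Data.List using (List; []; _∷_; _++_; map; length; lookup; allFin)
open import Data.List.Membership.Propositional using (_∈_; _∉_)
open import Data.List.Membership.Propositional.Properties using (∈-∃++; ∈-++⁻; ∈-++⁺ˡ; ∈-++⁺ʳ; ∈-allFin)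
open import Data.List.Relation.Binary.Permutation.Propositional.Properties using (map⁺; shift)
open import Data.List.Relation.Unary.All as All using ([])
open import Data.List.Relation.Unary.All.Properties using (¬Any⇒All¬)
open import Data.List.Relation.Unary.AllPairs using ([]; _∷_)
open import Data.List.Relation.Unary.Any using (here; there; index; any?)
open import Data.List.Relation.Unary.Any.Properties using (lookup-index)
open import Data.List.Relation.Unary.Unique.Propositional using (Unique)
open import Data.Nat hiding (_≟_)
open import Data.Nat.ListAction using (sum)
open import Data.Nat.ListAction.Properties using (sum-↭)
open import Data.Nat.Properties hiding (_≟_)
open import Algebra.Properties.CommutativeSemigroup +-commutativeSemigroup using (interchange)
open import Data.Product using (∃-syntax; _×_; _,_; proj₁; proj₂)
open import Data.Sum using (_⊎_; inj₁; inj₂)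
open import Function using (_∘_; Equivalence)
open import Relation.Binary.Construct.Closure.ReflexiveTransitive using (Star; ε; _◅_)
open import Relation.Binary.Definitions using (tri<; tri≈; tri>)
open import Relation.Binary.PropositionalEquality
open import Relation.Nullary using (¬_; Dec; yes; no; does; contradiction)
open import Relation.Nullary.Decidable using (_×-dec_; _⊎-dec_; dec-true; dec-false)
open import Data.Nat.DivMod using (_%_; m<n⇒m%n≡m; [m+kn]%n≡m%n; [m+n]%n≡m%n)
import Data.Product as Product

private
  variable
    n : ℕ

-- Counting edges inside a list of vertices.

degree : (Fin n → Fin n → Bool) → Fin n → List (Fin n) → ℕ
degree B v L = sum (map (λ w → b2n (B v w)) L)

-- Each vertex is counted against those after it, so prepending a vertex adds exactly its edges into
-- the list.
edges : (Fin n → Fin n → Bool) → List (Fin n) → ℕ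
edges B []      = 0
edges B (v ∷ L) = degree B v L + edges B L

sum-map-+ : ∀ {A : Set} (f g : A → ℕ) L → sum (map (λ x → f x + g x) L) ≡ sum (map f L) + sum (map g L)
sum-map-+ f g []      = refl
sum-map-+ f g (x ∷ L) = trans (cong (f x + g x +_) (sum-map-+ f g L)) (interchange (f x) (g x) _ _)

sum-map-mono : ∀ {A : Set} {f g : A → ℕ} L → (∀ {x} → x ∈ L → f x ≤ g x) → sum (map f L) ≤ sum (map g L)
sum-map-mono []      h = z≤n
sum-map-mono (x ∷ L) h = +-mono-≤ (h (here refl)) (sum-map-mono L (h ∘ there))

sum-map-⊆ : ∀ {A : Set} (f : A → ℕ) {L M} → Unique L → (∀ {x} → x ∈ L → x ∈ M) → sum (map f L) ≤ sum (map f M)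
sum-map-⊆ f []               L⊆M = z≤n
sum-map-⊆ f {x ∷ L} (x∉L ∷ L!) L⊆M with as , bs , refl ← ∈-∃++ (L⊆M (here refl)) = begin
  f x + sum (map f L)                       ≤⟨ +-monoʳ-≤ (f x) (sum-map-⊆ f L! L⊆rest) ⟩
  f x + sum (map f (as ++ bs))              ≡⟨ sum-↭ (map⁺ f (shift x as bs)) ⟨
  sum (map f (as ++ x ∷ bs))                ∎
  where
  open ≤-Reasoning
  L⊆rest : ∀ {y} → y ∈ L → y ∈ as ++ bs
  L⊆rest {y} y∈L with ∈-++⁻ as (L⊆M (there y∈L))
  ... | inj₁ y∈as         = ∈-++⁺ˡ y∈as
  ... | inj₂ (here refl)  = contradiction refl (All.lookup x∉L y∈L)
  ... | inj₂ (there y∈bs) = ∈-++⁺ʳ as y∈bs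

module _ (G : Graph n) where

  ascending : Fin n → Fin n → ℕ
  ascending v w = b2n (adj G v w ∧ (toℕ v <ᵇ toℕ w))

  ascendingSum : List (Fin n) → List (Fin n) → ℕ
  ascendingSum L M = sum (map (λ v → sum (map (ascending v) M)) L)

  -- This reconciles two conventions: `edgeCount` records an edge at its smaller endpoint, `edges`
  -- at the endpoint that comes first in the list.
  adj≤ascending : ∀ {v w} → v ≢ w → b2n (adj G v w) ≤ ascending v w + ascending w v
  adj≤ascending {v} {w} v≢w with <-cmp (toℕ v) (toℕ w)
  ... | tri≈ _ v≡w _ = contradiction (toℕ-injective v≡w) v≢w
  ... | tri< v<w _ _ rewrite Equivalence.to T-≡ (<⇒<ᵇ v<w) | ∧-identityʳ (adj G v w) = m≤m+n _ _
  ... | tri> _ _ w<v rewrite Equivalence.to T-≡ (<⇒<ᵇ w<v) | ∧-identityʳ (adj G w v) | adj-sym G v w = m≤n+m _ _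

  edges≤ascendingSum : ∀ {L} → Unique L → edges (adj G) L ≤ ascendingSum L L
  edges≤ascendingSum []                     = z≤n
  edges≤ascendingSum {v ∷ L} (v∉L ∷ L!) = begin
    degree (adj G) v L + edges (adj G) L
      ≤⟨ +-mono-≤ (sum-map-mono L λ w∈L → adj≤ascending (All.lookup v∉L w∈L)) (edges≤ascendingSum L!) ⟩
    sum (map (λ w → ascending v w + ascending w v) L) + ascendingSum L L
      ≡⟨ cong (_+ ascendingSum L L) (sum-map-+ (ascending v) (λ w → ascending w v) L) ⟩
    sum (map (ascending v) L) + sum (map (λ w → ascending w v) L) + ascendingSum L L
      ≡⟨ +-assoc (sum (map (ascending v) L)) _ _ ⟩
    sum (map (ascending v) L) + (sum (map (λ w → ascending w v) L) + ascendingSum L L)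
      ≡⟨ cong (sum (map (ascending v) L) +_) (sum-map-+ (λ w → ascending w v) (λ w → sum (map (ascending w) L)) L) ⟨
    sum (map (ascending v) L) + ascendingSum L (v ∷ L)
      ≤⟨ +-monoˡ-≤ (ascendingSum L (v ∷ L)) (m≤n+m _ (ascending v v)) ⟩
    ascendingSum (v ∷ L) (v ∷ L) ∎
    where open ≤-Reasoning

  edges≤edgeCount : ∀ {L} → Unique L → edges (adj G) L ≤ edgeCount G
  edges≤edgeCount {L} L! = begin
    edges (adj G) L                  ≤⟨ edges≤ascendingSum L! ⟩
    ascendingSum L L                 ≤⟨ sum-map-mono L (λ {v} _ → sum-map-⊆ (ascending v) L! (λ {x} _ → ∈-allFin x)) ⟩
    ascendingSum L (allFin n)        ≤⟨ sum-map-⊆ (λ v → sum (map (ascending v) (allFin n))) L! (λ {x} _ → ∈-allFin x) ⟩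
    edgeCount G                      ∎
    where open ≤-Reasoning

degree≥1 : (B : Fin n → Fin n → Bool) → ∀ {v w L} → w ∈ L → B v w ≡ true → 1 ≤ degree B v L
degree≥1 B {v} {w} {L = _ ∷ L} (here refl) e rewrite e = s≤s z≤n
degree≥1 B {v} {L = x ∷ L} (there w∈L) e = ≤-trans (degree≥1 B w∈L e) (m≤n+m _ (b2n (B v x)))

-- Induced edge bounds in connected graphs.

module _ (G : Graph n) (connected : Connected G) where

  exit : ∀ {L a b} → Star (Edge G) a b → a ∈ L → b ∉ L → ∃[ v ] ∃[ w ] w ∈ L × v ∉ L × adj G v w ≡ true
  exit ε a∈L b∉L = contradiction a∈L b∉L
  exit {L} (_◅_ {a} {c} ac path) a∈L b∉L with any? (c ≟_) L
  ... | yes c∈L = exit path c∈L b∉L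
  ... | no  c∉L = c , a , a∈L , c∉L , trans (adj-sym G c a) ac

  boundary : ∀ {L a} → a ∈ L → length L < n → ∃[ v ] ∃[ w ] w ∈ L × v ∉ L × adj G v w ≡ true
  boundary {L} {a} a∈L ∣L∣<n with v , v∉L ← missed ∣L∣<n (lookup L) =
    exit (connected a v) a∈L λ v∈L → v∉L (index v∈L) (lookup-index v∈L)

  -- Prepending a boundary vertex adds one to the length and at least one to the edges, so edges
  -- minus length never drops until all vertices are listed. `d` bounds the number of vertices still
  -- missing.
  grow : ∀ d {L a} → n ≤ length L + d → Unique L → a ∈ L → edges (adj G) L + n ≤ edgeCount G + length L
  grow d {L} n≤ L! a∈L with length L <? n
  ... | no ∣L∣≮n = +-mono-≤ (edges≤edgeCount G L!) (≮⇒≥ ∣L∣≮n)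
  grow zero    {L} n≤ L! a∈L | yes ∣L∣<n = contradiction (≤-trans n≤ (≤-reflexive (+-identityʳ _))) (<⇒≱ ∣L∣<n)
  grow (suc d) {L} n≤ L! a∈L | yes ∣L∣<n with v , w , w∈L , v∉L , vw ← boundary a∈L ∣L∣<n =
    ≤-pred (begin
      suc (edges (adj G) L + n)                     ≤⟨ +-monoˡ-≤ n (+-monoˡ-≤ (edges (adj G) L)
                                                         (degree≥1 (adj G) w∈L vw)) ⟩
      edges (adj G) (v ∷ L) + n                     ≤⟨ grow d (≤-trans n≤ (≤-reflexive (+-suc (length L) d)))
                                                          (¬Any⇒All¬ L v∉L ∷ L!) (there a∈L) ⟩
      edgeCount G + suc (length L)                  ≡⟨ +-suc (edgeCount G) (length L) ⟩
      suc (edgeCount G + length L)                  ∎)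
    where open ≤-Reasoning

  bicyclic-edges≤ : edgeCount G ≡ suc n → ∀ {L a} → Unique L → a ∈ L → edges (adj G) L ≤ suc (length L)
  bicyclic-edges≤ count {L} L! a∈L = +-cancelʳ-≤ n _ _ (begin
    edges (adj G) L + n         ≤⟨ grow n (m≤n+m n (length L)) L! a∈L ⟩
    edgeCount G + length L      ≡⟨ cong (_+ length L) count ⟩
    suc (n + length L)          ≡⟨ cong suc (+-comm n (length L)) ⟩
    suc (length L) + n          ∎)
    where open ≤-Reasoning

-- Removing an edge and deducing non-adjacency.

_⊑_ : (B C : Fin n → Fin n → Bool) → Set
B ⊑ C = ∀ v w → B v w ≡ true → C v w ≡ true

b2n-mono : ∀ {a b} → (a ≡ true → b ≡ true) → b2n a ≤ b2n b
b2n-mono {false} h = z≤n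
b2n-mono {true}  h rewrite h refl = ≤-refl

degree-mono : ∀ {B C : Fin n → Fin n → Bool} → B ⊑ C → ∀ v L → degree B v L ≤ degree C v L
degree-mono B⊑C v L = sum-map-mono L λ {w} _ → b2n-mono (B⊑C v w)

edges-mono : ∀ {B C : Fin n → Fin n → Bool} → B ⊑ C → ∀ L → edges B L ≤ edges C L
edges-mono B⊑C []      = z≤n
edges-mono B⊑C (v ∷ L) = +-mono-≤ (degree-mono B⊑C v L) (edges-mono B⊑C L)

degree-strict : ∀ {B C : Fin n → Fin n → Bool} → B ⊑ C → ∀ {v w L} → w ∈ L → B v w ≡ false → C v w ≡ true →
  degree B v L < degree C v L
degree-strict B⊑C {v} {L = x ∷ L} (here refl) b c rewrite b | c = s≤s (degree-mono B⊑C v L)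
degree-strict {B = B} {C} B⊑C {v} {L = x ∷ L} (there w∈L) b c =
  <-≤-trans (+-monoʳ-< (b2n (B v x)) (degree-strict B⊑C w∈L b c)) (+-monoˡ-≤ (degree C v L) (b2n-mono (B⊑C v x)))

-- Both orientations are assumed because the list order decides which of them is counted.
edges-strict : ∀ {B C : Fin n → Fin n → Bool} → B ⊑ C → ∀ {v w L} → v ∈ L → w ∈ L → v ≢ w →
  B v w ≡ false → B w v ≡ false → C v w ≡ true → C w v ≡ true → edges B L < edges C L
edges-strict B⊑C {L = _ ∷ L} (here refl) (here refl) v≢w _ _ _ _ = contradiction refl v≢w
edges-strict B⊑C {L = _ ∷ L} (here refl) (there w∈L) v≢w b b′ c c′ =
  +-mono-<-≤ (degree-strict B⊑C w∈L b c) (edges-mono B⊑C L)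
edges-strict B⊑C {L = _ ∷ L} (there v∈L) (here refl) v≢w b b′ c c′ =
  +-mono-<-≤ (degree-strict B⊑C v∈L b′ c′) (edges-mono B⊑C L)
edges-strict B⊑C {L = x ∷ L} (there v∈L) (there w∈L) v≢w b b′ c c′ =
  +-mono-≤-< (degree-mono B⊑C x L) (edges-strict B⊑C v∈L w∈L v≢w b b′ c c′)

SamePair : (x y v w : Fin n) → Set
SamePair x y v w = (v ≡ x × w ≡ y) ⊎ (v ≡ y × w ≡ x)

samePair? : (x y v w : Fin n) → Dec (SamePair x y v w)
samePair? x y v w = ((v ≟ x) ×-dec (w ≟ y)) ⊎-dec ((v ≟ y) ×-dec (w ≟ x))

cut : (x y : Fin n) → (Fin n → Fin n → Bool) → Fin n → Fin n → Bool
cut x y B v w = B v w ∧ not (does (samePair? x y v w))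

cut-⊑ : ∀ x y (B : Fin n → Fin n → Bool) → cut x y B ⊑ B
cut-⊑ x y B v w e with B v w
... | true = refl

cut-false : ∀ x y (B : Fin n → Fin n → Bool) {v w} → SamePair x y v w → cut x y B v w ≡ false
cut-false x y B {v} {w} p =
  trans (cong (λ b → B v w ∧ not b) (dec-true (samePair? x y v w) p)) (∧-zeroʳ (B v w))

cut-true : ∀ x y (B : Fin n → Fin n → Bool) {v w} → ¬ SamePair x y v w → B v w ≡ true → cut x y B v w ≡ true
cut-true x y B {v} {w} ¬p e =
  trans (cong (λ b → B v w ∧ not b) (dec-false (samePair? x y v w) ¬p)) (trans (∧-identityʳ (B v w)) e)

module _ (G : Graph n) (bicyclic : Bicyclic G) where

  -- Without the pair xy the list already spans the maximal |L| + 1 edges; the edge xy would be one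
  -- too many.
  non-adjacent : ∀ x y {L} → Unique L → x ∈ L → y ∈ L → x ≢ y →
    length L < edges (cut x y (adj G)) L → adj G x y ≡ false
  non-adjacent x y {L} L! x∈L y∈L x≢y many = ¬-not λ xy →
    <⇒≱ (≤-<-trans many (edges-strict (cut-⊑ x y (adj G)) x∈L y∈L x≢y
          (cut-false x y (adj G) (inj₁ (refl , refl))) (cut-false x y (adj G) (inj₂ (refl , refl)))
          xy (trans (adj-sym G y x) xy)))
        (bicyclic-edges≤ G (proj₁ bicyclic) (proj₂ bicyclic) L! x∈L)

-- Attaching the path h 1, …, h k to L; its foot h 0 should already lie in L.
ear : (ℕ → Fin n) → ℕ → List (Fin n) → List (Fin n)
ear h zero    L = L
ear h (suc k) L = h (suc k) ∷ ear h k L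

length-ear : ∀ (h : ℕ → Fin n) k L → length (ear h k L) ≡ k + length L
length-ear h zero    L = refl
length-ear h (suc k) L = cong suc (length-ear h k L)

⊆-ear : ∀ (h : ℕ → Fin n) k {L v} → v ∈ L → v ∈ ear h k L
⊆-ear h zero    v∈L = v∈L
⊆-ear h (suc k) v∈L = there (⊆-ear h k v∈L)

∈-ear⁺ : ∀ (h : ℕ → Fin n) {L} → h 0 ∈ L → ∀ k {i} → i ≤ k → h i ∈ ear h k L
∈-ear⁺ h h₀∈L zero    z≤n = h₀∈L
∈-ear⁺ h h₀∈L (suc k) i≤1+k with m≤n⇒m<n∨m≡n i≤1+k
... | inj₁ i<1+k = there (∈-ear⁺ h h₀∈L k (≤-pred i<1+k))
... | inj₂ refl  = here refl

∈-ear⁻ : ∀ (h : ℕ → Fin n) k {L v} → v ∈ ear h k L → v ∈ L ⊎ ∃[ i ] 1 ≤ i × i ≤ k × v ≡ h i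
∈-ear⁻ h zero    v∈L         = inj₁ v∈L
∈-ear⁻ h (suc k) (here refl) = inj₂ (suc k , s≤s z≤n , ≤-refl , refl)
∈-ear⁻ h (suc k) (there v∈)  with ∈-ear⁻ h k v∈
... | inj₁ v∈L                  = inj₁ v∈L
... | inj₂ (i , 1≤i , i≤k , e)  = inj₂ (i , 1≤i , m≤n⇒m≤1+n i≤k , e)

ear-unique : ∀ (h : ℕ → Fin n) k {L} → Unique L → (∀ {i} → 1 ≤ i → i ≤ k → h i ∉ L) →
  (∀ {i j} → i ≤ k → j ≤ k → h i ≡ h j → i ≡ j) → Unique (ear h k L)
ear-unique h zero    L! h∉L h-inj = L!
ear-unique h (suc k) L! h∉L h-inj = ¬Any⇒All¬ _ new ∷
  ear-unique h k L! (λ 1≤i i≤k → h∉L 1≤i (m≤n⇒m≤1+n i≤k))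
    (λ i≤k j≤k → h-inj (m≤n⇒m≤1+n i≤k) (m≤n⇒m≤1+n j≤k))
  where
  new : h (suc k) ∉ ear h k _
  new ∈ear with ∈-ear⁻ h k ∈ear
  ... | inj₁ ∈L                  = h∉L (s≤s z≤n) ≤-refl ∈L
  ... | inj₂ (i , 1≤i , i≤k , e) = <⇒≢ (s≤s i≤k) (sym (h-inj ≤-refl (m≤n⇒m≤1+n i≤k) e))

edges-path : ∀ (B : Fin n → Fin n → Bool) (h : ℕ → Fin n) k {L} → h 0 ∈ L →
  (∀ {i} → i < k → B (h (suc i)) (h i) ≡ true) → k + edges B L ≤ edges B (ear h k L)
edges-path B h zero    h₀∈L back = ≤-refl
edges-path B h (suc k) h₀∈L back =
  +-mono-≤ (degree≥1 B (∈-ear⁺ h h₀∈L k ≤-refl) (back ≤-refl)) (edges-path B h k h₀∈L (back ∘ m≤n⇒m≤1+n))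

-- The 2 + m new vertices each have an edge to their predecessor, and the last has a further one to
-- the foot.
edges-ear : ∀ (B : Fin n → Fin n → Bool) (h : ℕ → Fin n) m {L} → h 0 ∈ L →
  (∀ {i} → i < 2 + m → B (h (suc i)) (h i) ≡ true) → B (h (2 + m)) (h 0) ≡ true →
  3 + m + edges B L ≤ edges B (ear h (2 + m) L)
edges-ear B h m {L} h₀∈L back closing = +-mono-≤ {2} two (edges-path B h (suc m) h₀∈L (back ∘ m≤n⇒m≤1+n))
  where
  two : 2 ≤ degree B (h (2 + m)) (ear h (suc m) L)
  -- The predecessor heads the list and the foot lies in its tail, so the two edges are counted at
  -- different positions.
  two rewrite back {suc m} ≤-refl = s≤s (degree≥1 B (∈-ear⁺ h h₀∈L m z≤n) closing)

-- walk runs around a cycle of length 3 + m.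
record Loop (G : Graph n) : Set where
  field
    m         : ℕ
    walk      : ℕ → Fin n
    closed    : walk (3 + m) ≡ walk 0
    step      : ∀ {k} → k < 3 + m → adj G (walk k) (walk (suc k)) ≡ true
    injective : ∀ {i j} → i < 3 + m → j < 3 + m → walk i ≡ walk j → i ≡ j

  -- The last step wraps round to index 0, which `1 ≤ i` excludes as a target.
  walk-suc-injective : ∀ {k i} → k < 3 + m → 1 ≤ i → i < 3 + m → walk (suc k) ≡ walk i → suc k ≡ i
  walk-suc-injective {k} k<p 1≤i i<p e with m≤n⇒m<n∨m≡n k<p
  ... | inj₁ 1+k<p = injective 1+k<p i<p e
  ... | inj₂ refl  = contradiction (injective (s≤s z≤n) i<p (trans (sym closed) e)) (<⇒≢ 1≤i)

-- Here p and q are the cycle lengths of ∞(p, q, 1) minus 3.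
record Infinity (G : Graph n) : Set where
  field
    F₁ F₂ : Loop G
  open Loop F₁ public renaming
    ( m to p; walk to f; closed to f-closed; step to f-step; injective to f-inj
    ; walk-suc-injective to f-suc-inj )
  open Loop F₂ public using () renaming
    (m to q; walk to g; closed to g-closed; step to g-step; injective to g-inj)
  field
    base     : f 0 ≡ g 0
    disjoint : ∀ {i j} → i < 3 + p → j < 3 + q → f i ≡ g j → i ≡ 0 × j ≡ 0

swap : {G : Graph n} → Infinity G → Infinity G
swap I = record
  { F₁ = F₂ ; F₂ = F₁ ; base = sym base
  ; disjoint = λ i<q j<p e → Product.swap (disjoint j<p i<q (sym e))
  }
  where open Infinity I

-- Absence of further edges on and next to the two cycles.

module Chords {G : Graph n} (bicyclic : Bicyclic G) (I : Infinity G) where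
  open Infinity I

  -- The two cycles as successive ears on the junction, 5 + p + q vertices in all.
  support : List (Fin n)
  support = ear g (2 + q) (ear f (2 + p) (f 0 ∷ []))

  f∈ : ∀ {i} → i < 3 + p → f i ∈ support
  f∈ i<p = ⊆-ear g (2 + q) (∈-ear⁺ f (here refl) (2 + p) (≤-pred i<p))

  g₀∈ear : g 0 ∈ ear f (2 + p) (f 0 ∷ [])
  g₀∈ear = subst (_∈ ear f (2 + p) (f 0 ∷ [])) base (∈-ear⁺ f (here refl) (2 + p) z≤n)

  g∈ : ∀ {j} → j < 3 + q → g j ∈ support
  g∈ j<q = ∈-ear⁺ g g₀∈ear (2 + q) (≤-pred j<q)

  f-suc∈ : ∀ {k} → k < 3 + p → f (suc k) ∈ support
  f-suc∈ k<p with m≤n⇒m<n∨m≡n k<p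
  ... | inj₁ 1+k<p = f∈ 1+k<p
  ... | inj₂ refl  = subst (_∈ support) (sym f-closed) (f∈ (s≤s z≤n))

  g-suc∈ : ∀ {k} → k < 3 + q → g (suc k) ∈ support
  g-suc∈ k<q with m≤n⇒m<n∨m≡n k<q
  ... | inj₁ 1+k<q = g∈ 1+k<q
  ... | inj₂ refl  = subst (_∈ support) (sym g-closed) (g∈ (s≤s z≤n))

  ∈support⁻ : ∀ {v} → v ∈ support → (∃[ i ] i < 3 + p × v ≡ f i) ⊎ (∃[ j ] j < 3 + q × v ≡ g j)
  ∈support⁻ v∈ with ∈-ear⁻ g (2 + q) v∈
  ... | inj₂ (j , _ , j≤ , e) = inj₂ (j , s≤s j≤ , e)
  ... | inj₁ v∈f with ∈-ear⁻ f (2 + p) v∈f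
  ...   | inj₂ (i , _ , i≤ , e) = inj₁ (i , s≤s i≤ , e)
  ...   | inj₁ (here e)         = inj₁ (0 , s≤s z≤n , e)

  unique : Unique support
  unique = ear-unique g (2 + q)
    (ear-unique f (2 + p) ([] ∷ []) f∉ (λ i≤ j≤ → f-inj (s≤s i≤) (s≤s j≤)))
    g∉ (λ i≤ j≤ → g-inj (s≤s i≤) (s≤s j≤))
    where
    f∉ : ∀ {i} → 1 ≤ i → i ≤ 2 + p → f i ∉ f 0 ∷ []
    f∉ 1≤i i≤ (here e) = <⇒≢ 1≤i (sym (f-inj (s≤s i≤) (s≤s z≤n) e))
    g∉ : ∀ {j} → 1 ≤ j → j ≤ 2 + q → g j ∉ ear f (2 + p) (f 0 ∷ [])
    g∉ 1≤j j≤ g∈ear with ∈-ear⁻ f (2 + p) g∈ear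
    ... | inj₁ (here e)         = <⇒≢ 1≤j (sym (proj₂ (disjoint (s≤s z≤n) (s≤s j≤) (sym e))))
    ... | inj₂ (i , _ , i≤ , e) = <⇒≢ 1≤j (sym (proj₂ (disjoint (s≤s i≤) (s≤s j≤) (sym e))))

  length-support : length support ≡ 2 + q + (2 + p + 1)
  length-support = trans (length-ear g (2 + q) _) (cong (2 + q +_) (length-ear f (2 + p) (f 0 ∷ [])))

  module _ (x y : Fin n)
    (avoid-f : ∀ {k} → k < 3 + p → ¬ SamePair x y (f k) (f (suc k)))
    (avoid-g : ∀ {k} → k < 3 + q → ¬ SamePair x y (g k) (g (suc k))) where

    B : Fin n → Fin n → Bool
    B = cut x y (adj G)

    reversed : ∀ {v w} → ¬ SamePair x y v w → adj G v w ≡ true → B w v ≡ true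
    reversed ¬p e = cut-true x y (adj G)
      (λ { (inj₁ (a , b)) → ¬p (inj₂ (b , a)) ; (inj₂ (a , b)) → ¬p (inj₁ (b , a)) }) (trans (adj-sym G _ _) e)

    -- As xy is not a cycle edge, all 6 + p + q cycle edges survive the cut, one more than there are
    -- vertices.
    edges-support : length support < edges B support
    edges-support = begin-strict
      length support               ≡⟨ length-support ⟩
      2 + q + (2 + p + 1)          <⟨ +-mono-<-≤ (n<1+n (2 + q)) (≤-reflexive (+-suc (2 + p) 0)) ⟩
      3 + q + (3 + p + 0)          ≤⟨ +-monoʳ-≤ (3 + q) (edges-ear B f p (here refl) f-back f-last) ⟩
      3 + q + edges B (ear f (2 + p) (f 0 ∷ []))
                                   ≤⟨ edges-ear B g q g₀∈ear g-back g-last ⟩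
      edges B support              ∎
      where
      open ≤-Reasoning
      f-back : ∀ {k} → k < 2 + p → B (f (suc k)) (f k) ≡ true
      f-back k< = reversed (avoid-f (m≤n⇒m≤1+n k<)) (f-step (m≤n⇒m≤1+n k<))
      g-back : ∀ {k} → k < 2 + q → B (g (suc k)) (g k) ≡ true
      g-back k< = reversed (avoid-g (m≤n⇒m≤1+n k<)) (g-step (m≤n⇒m≤1+n k<))
      f-last : B (f (2 + p)) (f 0) ≡ true
      f-last = subst (λ v → B (f (2 + p)) v ≡ true) f-closed
        (cut-true x y (adj G) (avoid-f ≤-refl) (f-step ≤-refl))
      g-last : B (g (2 + q)) (g 0) ≡ true
      g-last = subst (λ v → B (g (2 + q)) v ≡ true) g-closed
        (cut-true x y (adj G) (avoid-g ≤-refl) (g-step ≤-refl))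

  -- A step along either cycle never touches an off-junction vertex of the other, so this pair is
  -- not a cycle edge.
  f≁g : ∀ {i j} → 1 ≤ i → i < 3 + p → 1 ≤ j → j < 3 + q → adj G (f i) (g j) ≡ false
  f≁g {i} {j} 1≤i i<p 1≤j j<q = non-adjacent G bicyclic (f i) (g j) unique (f∈ i<p) (g∈ j<q)
    (λ e → <⇒≢ 1≤i (sym (proj₁ (disjoint i<p j<q e))))
    (edges-support (f i) (g j)
      (λ k<p → λ { (inj₁ (_ , e)) → f-suc≢g k<p e ; (inj₂ (e , _)) → f≢g k<p e })
      (λ k<q → λ { (inj₁ (e , _)) → g≢f k<q e ; (inj₂ (_ , e)) → g-suc≢f k<q e }))
    where
    f≢g : ∀ {k} → k < 3 + p → f k ≢ g j
    f≢g k<p e = <⇒≢ 1≤j (sym (proj₂ (disjoint k<p j<q e)))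
    g≢f : ∀ {k} → k < 3 + q → g k ≢ f i
    g≢f k<q e = <⇒≢ 1≤i (sym (proj₁ (disjoint i<p k<q (sym e))))
    f-suc≢g : ∀ {k} → k < 3 + p → f (suc k) ≢ g j
    f-suc≢g k<p e with m≤n⇒m<n∨m≡n k<p
    ... | inj₁ 1+k<p = f≢g 1+k<p e
    ... | inj₂ refl  = f≢g (s≤s z≤n) (trans (sym f-closed) e)
    g-suc≢f : ∀ {k} → k < 3 + q → g (suc k) ≢ f i
    g-suc≢f k<q e with m≤n⇒m<n∨m≡n k<q
    ... | inj₁ 1+k<q = g≢f 1+k<q e
    ... | inj₂ refl  = g≢f (s≤s z≤n) (trans (sym g-closed) e)

  -- Steps between consecutive indices are excluded by hypothesis; the wrapping step and the steps
  -- of the other cycle cannot join two off-junction vertices of this one.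
  f≁f : ∀ {i j} → 1 ≤ i → i < 3 + p → 1 ≤ j → j < 3 + p → i ≢ j → suc i ≢ j → suc j ≢ i →
    adj G (f i) (f j) ≡ false
  f≁f {i} {j} 1≤i i<p 1≤j j<p i≢j 1+i≢j 1+j≢i =
    non-adjacent G bicyclic (f i) (f j) unique (f∈ i<p) (f∈ j<p)
    (i≢j ∘ f-inj i<p j<p)
    (edges-support (f i) (f j)
      (λ k<p → λ
        { (inj₁ (e , e′)) → 1+i≢j (trans (cong suc (sym (f-inj k<p i<p e))) (f-suc-inj k<p 1≤j j<p e′))
        ; (inj₂ (e , e′)) → 1+j≢i (trans (cong suc (sym (f-inj k<p j<p e))) (f-suc-inj k<p 1≤i i<p e′))
        })
      (λ k<q → λ { (inj₁ (e , _)) → g≢f 1≤i i<p k<q e ; (inj₂ (e , _)) → g≢f 1≤j j<p k<q e }))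
    where
    g≢f : ∀ {i} → 1 ≤ i → i < 3 + p → ∀ {k} → k < 3 + q → g k ≢ f i
    g≢f 1≤i i<p k<q e = <⇒≢ 1≤i (sym (proj₁ (disjoint i<p k<q (sym e))))

  -- Adjoining `u` with its edge to `t` adds one vertex and one edge to the saturated support, so a
  -- second edge from `u` would exceed the bound.
  outside≁ : ∀ {u t s} → u ∉ support → t ∈ support → adj G u t ≡ true → s ∈ support → s ≢ t → adj G u s ≡ false
  outside≁ {u} {t} {s} u∉ t∈ ut s∈ s≢t =
    non-adjacent G bicyclic u s (¬Any⇒All¬ support u∉ ∷ unique) (here refl) (there s∈) (u≢ s∈ ∘ sym)
      (+-mono-≤-<
        (degree≥1 (cut u s (adj G)) t∈
          (cut-true u s (adj G) (λ { (inj₁ (_ , e)) → s≢t (sym e) ; (inj₂ (e , _)) → u≢ s∈ (sym e) }) ut))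
        (edges-support u s
          (λ k<p → λ { (inj₁ (e , _)) → u≢ (f∈ k<p) e ; (inj₂ (_ , e)) → u≢ (f-suc∈ k<p) e })
          (λ k<q → λ { (inj₁ (e , _)) → u≢ (g∈ k<q) e ; (inj₂ (_ , e)) → u≢ (g-suc∈ k<q) e })))
    where
    u≢ : ∀ {v} → v ∈ support → v ≢ u
    u≢ v∈ refl = u∉ v∈

-- Choosing the six vertices.

module _ {G : Graph n} (bicyclic : Bicyclic G) (I : Infinity G) where
  open Infinity I
  open Chords bicyclic I

  -- Length at least 5 keeps `f 1` to `f 4` off the junction. The cycle edge from `f 2` to `f 3`
  -- joins y₁ to x₂, which a pendant matching permits.
  long-matching : 2 ≤ p → PendantMatching G
  long-matching 2≤p = record
    { x₁y₁ = f-step 1<p ; x₂y₂ = f-step 3<p ; x₃y₃ = g-step 1<q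
    ; x₁x₂ = f≁f ≤-refl 1<p (s≤s z≤n) 3<p (λ ()) (λ ()) (λ ())
    ; x₁y₂ = f≁f ≤-refl 1<p (s≤s z≤n) 4<p (λ ()) (λ ()) (λ ())
    ; x₁x₃ = f≁g ≤-refl 1<p ≤-refl 1<q
    ; x₁y₃ = f≁g ≤-refl 1<p (s≤s z≤n) 2<q
    ; x₂x₃ = f≁g (s≤s z≤n) 3<p ≤-refl 1<q
    ; x₂y₃ = f≁g (s≤s z≤n) 3<p (s≤s z≤n) 2<q
    }
    where
    1<p : 1 < 3 + p
    1<p = s≤s (s≤s z≤n)
    3<p : 3 < 3 + p
    3<p = +-monoʳ-< 3 (<⇒≤ 2≤p)
    4<p : 4 < 3 + p
    4<p = +-monoʳ-≤ 3 2≤p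
    1<q : 1 < 3 + q
    1<q = s≤s (s≤s z≤n)
    2<q : 2 < 3 + q
    2<q = s≤s (s≤s (s≤s z≤n))

  -- Take x₁y₁ from `u` to `f i`, x₂y₂ on the f-cycle avoiding `f i`, and x₃y₃ from `g 1` to `g 2`.
  -- Only x₂ must be off the junction; y₂ may be the junction.
  attached-matching : ∀ {u i} → u ∉ support → i < 3 + p → adj G u (f i) ≡ true → p ≤ 1 → PendantMatching G
  attached-matching {u} {i} u∉ i<p ufᵢ p≤1 = choose i i<p ufᵢ
    where
    g≢f : ∀ {i j} → i < 3 + p → j < 3 + q → 1 ≤ j → g j ≢ f i
    g≢f i<p j<q 1≤j e = <⇒≢ 1≤j (sym (proj₂ (disjoint i<p j<q (sym e))))

    1<q : 1 < 3 + q
    1<q = s≤s (s≤s z≤n)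
    2<q : 2 < 3 + q
    2<q = s≤s (s≤s (s≤s z≤n))

    via : ∀ {i j k} → i < 3 + p → adj G u (f i) ≡ true → 1 ≤ j → j < 3 + p →
      adj G (f j) (f k) ≡ true → f k ∈ support → f j ≢ f i → f k ≢ f i → PendantMatching G
    via i<p ufᵢ 1≤j j<p fⱼfₖ fₖ∈ fⱼ≢fᵢ fₖ≢fᵢ = record
      { x₁y₁ = ufᵢ ; x₂y₂ = fⱼfₖ ; x₃y₃ = g-step 1<q
      ; x₁x₂ = outside≁ u∉ (f∈ i<p) ufᵢ (f∈ j<p) fⱼ≢fᵢ
      ; x₁y₂ = outside≁ u∉ (f∈ i<p) ufᵢ fₖ∈ fₖ≢fᵢ
      ; x₁x₃ = outside≁ u∉ (f∈ i<p) ufᵢ (g∈ 1<q) (g≢f i<p 1<q ≤-refl)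
      ; x₁y₃ = outside≁ u∉ (f∈ i<p) ufᵢ (g∈ 2<q) (g≢f i<p 2<q (s≤s z≤n))
      ; x₂x₃ = f≁g 1≤j j<p ≤-refl 1<q
      ; x₂y₃ = f≁g 1≤j j<p (s≤s z≤n) 2<q
      }

    0<p : 0 < 3 + p
    0<p = s≤s z≤n
    1<p : 1 < 3 + p
    1<p = s≤s (s≤s z≤n)
    2<p : 2 < 3 + p
    2<p = s≤s (s≤s (s≤s z≤n))

    f-≢ : ∀ {i j} → i < 3 + p → j < 3 + p → i ≢ j → f i ≢ f j
    f-≢ i<p j<p i≢j e = i≢j (f-inj i<p j<p e)

    choose : ∀ i → i < 3 + p → adj G u (f i) ≡ true → PendantMatching G
    choose 0 i<p ufᵢ = via i<p ufᵢ (s≤s z≤n) 1<p (f-step 1<p) (f∈ 2<p) (f-≢ 1<p i<p λ ()) (f-≢ 2<p i<p λ ())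
    -- On a triangle `f 3` is the junction again, so the wrap-around versions of membership and
    -- injectivity are used.
    choose 1 i<p ufᵢ = via i<p ufᵢ (s≤s z≤n) 2<p (f-step 2<p) (f-suc∈ 2<p) (f-≢ 2<p i<p λ ())
      (λ e → contradiction (f-suc-inj 2<p ≤-refl 1<p e) λ ())
    choose 2 i<p ufᵢ = via i<p ufᵢ ≤-refl 1<p (trans (adj-sym G (f 1) (f 0)) (f-step 0<p)) (f∈ 0<p)
      (f-≢ 1<p i<p λ ()) (f-≢ 0<p i<p λ ())
    choose 3 i<p ufᵢ = via i<p ufᵢ (s≤s z≤n) 2<p (trans (adj-sym G (f 2) (f 1)) (f-step 1<p)) (f∈ 1<p)
      (f-≢ 2<p i<p λ ()) (f-≢ 1<p i<p λ ())
    choose (suc (suc (suc (suc i)))) i<p ufᵢ =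
      contradiction (≤-trans i<p (+-monoʳ-≤ 3 p≤1)) λ { (s≤s (s≤s (s≤s (s≤s ())))) }

  length-support≤7 : p ≤ 1 → q ≤ 1 → length support ≤ 7
  length-support≤7 p≤1 q≤1 = ≤-trans (≤-reflexive length-support)
    (+-mono-≤ (+-monoʳ-≤ 2 q≤1) (+-monoˡ-≤ 1 (+-monoʳ-≤ 2 p≤1)))

infinity⇒matching : {G : Graph n} → Bicyclic G → 8 ≤ n → Infinity G → PendantMatching G
infinity⇒matching {n} {G} bicyclic 8≤n I with 2 ≤? Infinity.p I | 2 ≤? Infinity.q I
... | yes 2≤p | _       = long-matching bicyclic I 2≤p
... | no  _   | yes 2≤q = long-matching bicyclic (swap I) 2≤q
... | no 2≰p  | no 2≰q  = attach (boundary G (proj₁ bicyclic) (f∈ (s≤s z≤n))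
                            (≤-trans (s≤s (length-support≤7 bicyclic I p≤1 q≤1)) 8≤n))
  where
  open Infinity I
  open Chords bicyclic I
  p≤1 : p ≤ 1
  p≤1 = ≤-pred (≰⇒> 2≰p)
  q≤1 : q ≤ 1
  q≤1 = ≤-pred (≰⇒> 2≰q)
  attach : (∃[ u ] ∃[ w ] w ∈ support × u ∉ support × adj G u w ≡ true) → PendantMatching G
  attach (u , w , w∈ , u∉ , uw) with ∈support⁻ w∈
  ... | inj₁ (i , i<p , refl) = attached-matching bicyclic I u∉ i<p uw p≤1
  ... | inj₂ (j , j<q , refl) = attached-matching bicyclic (swap I) u∉swap j<q uw q≤1
    where
    -- Exchanging the cycles lists the same vertices in another order.
    u∉swap : u ∉ Chords.support bicyclic (swap I)
    u∉swap u∈ with Chords.∈support⁻ bicyclic (swap I) u∈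
    ... | inj₁ (k , k<q , e) = u∉ (subst (_∈ support) (sym e) (g∈ k<q))
    ... | inj₂ (k , k<p , e) = u∉ (subst (_∈ support) (sym e) (f∈ k<p))

-- From cycles indexed by `Fin` to walks that start at the junction.

toℕ-next : ∀ {m} (j : Fin (suc m)) → (toℕ j ≡ m × toℕ (next j) ≡ 0) ⊎ toℕ (next j) ≡ suc (toℕ j)
toℕ-next {zero}  zero    = inj₁ (refl , refl)
toℕ-next {suc m} zero    = inj₂ refl
toℕ-next {suc m} (suc j) with next j | toℕ-next j
... | zero  | inj₁ (e , _) = inj₁ (cong suc e , refl)
... | suc k | inj₂ e       = inj₂ (cong suc e)

turn : ∀ {m} → Fin (suc m) → ℕ → Fin (suc m)
turn a zero    = a
turn a (suc k) = nextFin (turn a k)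

-- `turn` is addition modulo `suc m`, and r counts the wrap-arounds.
toℕ-turn : ∀ {m} (a : Fin (suc m)) k → ∃[ r ] toℕ a + k ≡ toℕ (turn a k) + r * suc m
toℕ-turn a zero    = 0 , refl
toℕ-turn {m} a (suc k) with r , e ← toℕ-turn a k | toℕ-next (turn a k) | nextFin≡next m (turn a k)
... | inj₁ (last , wrapped) | n≡ = suc r , (begin
  toℕ a + suc k                               ≡⟨ +-suc (toℕ a) k ⟩
  suc (toℕ a + k)                             ≡⟨ cong suc e ⟩
  suc (toℕ (turn a k) + r * suc m)            ≡⟨ cong (λ x → suc (x + r * suc m)) last ⟩
  suc r * suc m                               ≡⟨ cong (_+ suc r * suc m) (trans (cong toℕ n≡) wrapped) ⟨
  toℕ (turn a (suc k)) + suc r * suc m        ∎)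
  where open ≡-Reasoning
... | inj₂ step | n≡ = r , (begin
  toℕ a + suc k                               ≡⟨ +-suc (toℕ a) k ⟩
  suc (toℕ a + k)                             ≡⟨ cong suc e ⟩
  suc (toℕ (turn a k) + r * suc m)            ≡⟨ cong (_+ r * suc m) (trans (cong toℕ n≡) step) ⟨
  toℕ (turn a (suc k)) + r * suc m            ∎)
  where open ≡-Reasoning

turn-closed : ∀ {m} (a : Fin (suc m)) → turn a (suc m) ≡ a
turn-closed {m} a with r , e ← toℕ-turn a (suc m) = toℕ-injective (begin
  toℕ (turn a (suc m))                          ≡⟨ m<n⇒m%n≡m (toℕ<n (turn a (suc m))) ⟨
  toℕ (turn a (suc m)) % suc m                  ≡⟨ [m+kn]%n≡m%n (toℕ (turn a (suc m))) r (suc m) ⟨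
  (toℕ (turn a (suc m)) + r * suc m) % suc m    ≡⟨ cong (_% suc m) e ⟨
  (toℕ a + suc m) % suc m                       ≡⟨ [m+n]%n≡m%n (toℕ a) (suc m) ⟩
  toℕ a % suc m                                 ≡⟨ m<n⇒m%n≡m (toℕ<n a) ⟩
  toℕ a                                         ∎)
  where open ≡-Reasoning

-- Equal positions force strictly more wrap-arounds after j steps than after i, and hence j ≥
-- `suc m`.
turn-≢ : ∀ {m} (a : Fin (suc m)) {i j} → i < j → j < suc m → turn a i ≢ turn a j
turn-≢ {m} a {i} {j} i<j j<p e with r , eᵢ ← toℕ-turn a i | s , eⱼ ← toℕ-turn a j =
  <⇒≱ j<p (+-cancelˡ-≤ (toℕ a) (suc m) j (begin
    toℕ a + suc m                             ≤⟨ +-monoˡ-≤ (suc m) (m≤m+n (toℕ a) i) ⟩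
    toℕ a + i + suc m                         ≡⟨ cong (_+ suc m) eᵢ ⟩
    toℕ (turn a i) + r * suc m + suc m        ≡⟨ +-assoc (toℕ (turn a i)) (r * suc m) (suc m) ⟩
    toℕ (turn a i) + (r * suc m + suc m)      ≡⟨ cong₂ _+_ (cong toℕ e) (+-comm (r * suc m) (suc m)) ⟩
    toℕ (turn a j) + suc r * suc m            ≤⟨ +-monoʳ-≤ (toℕ (turn a j)) (*-monoˡ-≤ (suc m) r<s) ⟩
    toℕ (turn a j) + s * suc m                ≡⟨ eⱼ ⟨
    toℕ a + j                                 ∎))
  where
  open ≤-Reasoning
  r<s : r < s
  r<s = *-cancelʳ-< (suc m) r s (+-cancelˡ-< (toℕ (turn a j)) (r * suc m) (s * suc m) (begin-strict
    toℕ (turn a j) + r * suc m     ≡⟨ cong (λ x → toℕ x + r * suc m) e ⟨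
    toℕ (turn a i) + r * suc m     ≡⟨ eᵢ ⟨
    toℕ a + i                      <⟨ +-monoʳ-< (toℕ a) i<j ⟩
    toℕ a + j                      ≡⟨ eⱼ ⟩
    toℕ (turn a j) + s * suc m     ∎))

turn-injective : ∀ {m} (a : Fin (suc m)) {i j} → i < suc m → j < suc m → turn a i ≡ turn a j → i ≡ j
turn-injective a {i} {j} i<p j<p e with <-cmp i j
... | tri< i<j _ _ = contradiction e (turn-≢ a i<j j<p)
... | tri≈ _ i≡j _ = i≡j
... | tri> _ _ j<i = contradiction (sym e) (turn-≢ a j<i i<p)

-- Starting the walk at `a` gives the junction index 0.
cycle⇒loop : {G : Graph n} → ∀ {m} {v : Fin (3 + m) → Fin n} → IsCycle G (3 + m) v → Fin (3 + m) → Loop G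
cycle⇒loop {m = m} {v} (_ , v-inj , v-step) a = record
  { m         = m
  ; walk      = v ∘ turn a
  ; closed    = cong v (turn-closed a)
  ; step      = λ {k} _ → v-step (turn a k)
  ; injective = λ i<p j<p e → turn-injective a i<p j<p (v-inj e)
  }

containsInfinity⇒infinity : {G : Graph n} → ContainsInfinity G → Infinity G
containsInfinity⇒infinity
  (_ , _ , u , w , cycle@(s≤s (s≤s (s≤s z≤n)) , _) , cycle′@(s≤s (s≤s (s≤s z≤n)) , _) , a , b , ua≡wb , meet) = record
  { F₁       = cycle⇒loop cycle a
  ; F₂       = cycle⇒loop cycle′ b
  ; base     = ua≡wb
  ; disjoint = λ {i} {j} i<p j<q e →
      turn-injective a i<p (s≤s z≤n) (proj₁ (meet (turn a i) (turn b j) e)) ,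
      turn-injective b j<q (s≤s z≤n) (proj₂ (meet (turn a i) (turn b j) e))
  }

theorem5p5 : (n : ℕ) → 8 ≤ n → (Γ : SignedGraph n) → InBnPP n (graph Γ) →
    η Γ ≤ n ∸ 6
theorem5p5 n 8≤n Γ (bicyclic , ∞) =
  pendantMatching⇒η≤ Γ (≤-trans (m≤n+m 6 2) 8≤n)
    (infinity⇒matching bicyclic 8≤n (containsInfinity⇒infinity ∞))
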